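{- Let $A_n := |P(S, n\times n)|$ be the number of distinct $n\times n$ patterns occurring in the 2-dimensional paperfolding structure $S$ (defined in the context). Then $A_1=4$, $A_2=68$, and for every integer $n\geq 3$, \[ A_n = 12 n^2 + 24\, n\, 2^{\alpha} - 16\cdot 4^{\alpha} - 4, \qquad \text{where } \alpha=\lfloor \log_2(n-1)\rfloor. \]
   Context: Let $\mathcal{A}=\{\mathtt{A},\mathtt{B},\dots,\mathtt{P}\}$ (16 letters) and $\mathcal{B}=\{\mathtt{0},\mathtt{1},\mathtt{2},\mathtt{3}\}$. A letter-to-block map assigns to each letter a $2\times 2$ matrix; we write a block as $(w\,x / y\,z)$ meaning first row $w\,x$, second row $y\,z$. The substitution $\mu$ on $\mathcal{A}$ is: $\mathtt{A}\mapsto(\mathtt{A\,F}/\mathtt{G\,C})$, $\mathtt{B}\mapsto(\mathtt{A\,F}/\mathtt{H\,D})$, $\mathtt{C}\mapsto(\mathtt{B\,E}/\mathtt{G\,C})$, $\mathtt{D}\mapsto(\mathtt{B\,E}/\mathtt{H\,D})$, $\mathtt{E}\mapsto(\mathtt{A\,N}/\mathtt{G\,K})$, $\mathtt{F}\mapsto(\mathtt{A\,N}/\mathtt{H\,L})$, $\mathtt{G}\mapsto(\mathtt{B\,M}/\mathtt{G\,K})$, $\mathtt{H}\mapsto(\mathtt{B\,M}/\mathtt{H\,L})$, $\mathtt{I}\mapsto(\mathtt{I\,F}/\mathtt{O\,C})$, $\mathtt{J}\mapsto(\mathtt{I\,F}/\mathtt{P\,D})$, $\mathtt{K}\mapsto(\mathtt{J\,E}/\mathtt{O\,C})$,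 $\mathtt{L}\mapsto(\mathtt{J\,E}/\mathtt{P\,D})$, $\mathtt{M}\mapsto(\mathtt{I\,N}/\mathtt{O\,K})$, $\mathtt{N}\mapsto(\mathtt{I\,N}/\mathtt{P\,L})$, $\mathtt{O}\mapsto(\mathtt{J\,M}/\mathtt{O\,K})$, $\mathtt{P}\mapsto(\mathtt{J\,M}/\mathtt{P\,L})$. The map $\phi$ from $\mathcal{A}$ to $2\times2$ blocks over $\mathcal{B}$ is: $\mathtt{A}\mapsto(01/00)$, $\mathtt{B}\mapsto(01/11)$, $\mathtt{C}\mapsto(10/00)$, $\mathtt{D}\mapsto(10/11)$, $\mathtt{E}\mapsto(03/02)$, $\mathtt{F}\mapsto(03/13)$, $\mathtt{G}\mapsto(12/02)$, $\mathtt{H}\mapsto(12/13)$, $\mathtt{I}\mapsto(21/20)$, $\mathtt{J}\mapsto(21/31)$, $\mathtt{K}\mapsto(30/20)$, $\mathtt{L}\mapsto(30/31)$, $\mathtt{M}\mapsto(23/22)$, $\mathtt{N}\mapsto(23/33)$, $\mathtt{O}\mapsto(32/22)$, $\mathtt{P}\mapsto(32/33)$. For an $m\times n$ matrix $X$ over $\mathcal{A}$, $\mu(X)$ (resp. $\phi(X)$) is the $2m\times 2n$ matrix obtained by replacing each entry $X_{r,c}$ by the block $\mu(X_{r,c})$ (resp. $\phi(X_{r,c})$) in rows $2r-1,2r$ and columns $2c-1,2c$; $\mu^0$ is the identity and $\mu^k=\mu^{k-1}\circ\mu$. Set $T_k:=\mu^k(\mathtt{N})$ ($2^k\times 2^k$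 matrix). A pattern of a matrix $X$ is a contiguous submatrix; $P(X,m\times n)$ is the set of all $m\times n$ contiguous submatrices of $X$. For the limit structures put $P(T,m\times n):=\bigcup_{k\ge0}P(T_k,m\times n)$ and $P(S,m\times n):=\bigcup_{k\ge0}P(\phi(T_k),m\times n)$ (here $T_k$ is the upper-right $2^k\times2^k$ block of $T_{k+1}$, and $\phi(T_k)$, after decorating each symbol of $\mathcal{B}$ with a pair of mountain/valley creases, is the upper-right quadrant of the crease pattern obtained by folding a square paper $k+1$ times alternately in the two axis directions). -}

module Defs where

open import Data.Nat using (ℕ; zero; suc; _+_; _*_; _≤_; _^_)
open import Data.Fin using (Fin; toℕ)
open import Data.Vec using (Vec; []; _∷_; map; concat; lookup)
open import Data.Maybe using (Maybe; just; nothing)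
open import Data.Product using (Σ; ∃; _×_; _,_)
open import Data.List using (List; length)
open import Data.List.Membership.Propositional using (_∈_)
open import Data.List.Relation.Unary.Unique.Propositional using (Unique)
open import Relation.Binary.PropositionalEquality using (_≡_)
open import Function.Bundles using (_⇔_)

data Letter : Set where
  A B C D E F G H I J K L M N O P : Letter

data Sym : Set where
  s0 s1 s2 s3 : Sym

Mat : Set → ℕ → ℕ → Set
Mat X m n = Vec (Vec X n) m

-- a 2×2 block (w x / y z)
record Block (X : Set) : Set where
  constructor blk
  field
    w x y z : X
open Block public

expand : {X Y : Set} {m n : ℕ} → (X → Block Y) → Mat X m n → Mat Y (m * 2) (n * 2)
expand f rows = concat (map (λ r → concat (map (λ a → w (f a) ∷ x (f a) ∷ []) r)
                                  ∷ concat (map (λ a → y (f a) ∷ z (f a) ∷ []) r)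
                                  ∷ []) rows)

μ : Letter → Block Letter
μ A = blk A F G C
μ B = blk A F H D
μ C = blk B E G C
μ D = blk B E H D
μ E = blk A N G K
μ F = blk A N H L
μ G = blk B M G K
μ H = blk B M H L
μ I = blk I F O C
μ J = blk I F P D
μ K = blk J E O C
μ L = blk J E P D
μ M = blk I N O K
μ N = blk I N P L
μ O = blk J M O K
μ P = blk J M P L

φ : Letter → Block Sym
φ A = blk s0 s1 s0 s0
φ B = blk s0 s1 s1 s1
φ C = blk s1 s0 s0 s0
φ D = blk s1 s0 s1 s1
φ E = blk s0 s3 s0 s2
φ F = blk s0 s3 s1 s3
φ G = blk s1 s2 s0 s2
φ H = blk s1 s2 s1 s3
φ I = blk s2 s1 s2 s0
φ J = blk s2 s1 s3 s1
φ K = blk s3 s0 s2 s0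
φ L = blk s3 s0 s3 s1
φ M = blk s2 s3 s2 s2
φ N = blk s2 s3 s3 s3
φ O = blk s3 s2 s2 s2
φ P = blk s3 s2 s3 s3

side : ℕ → ℕ
side zero    = 1
side (suc k) = side k * 2

T : (k : ℕ) → Mat Letter (side k) (side k)
T zero    = (N ∷ []) ∷ []
T (suc k) = expand μ (T k)

ST : (k : ℕ) → Mat Sym (side k * 2) (side k * 2)
ST k = expand φ (T k)

at : {X : Set} {n : ℕ} → Vec X n → ℕ → Maybe X
at []       _       = nothing
at (a ∷ _)  zero    = just a
at (_ ∷ as) (suc i) = at as i

entry : {X : Set} {m n : ℕ} → Mat X m n → ℕ → ℕ → Maybe X
entry rows i j with at rows i
... | just r  = at r j
... | nothing = nothing

OccursAt : {X : Set} {p q m n : ℕ} → Mat X p q → Mat X m n → ℕ → ℕ → Set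
OccursAt {p = p} {q} {m} {n} Q X i j =
  (i + p ≤ m) × (j + q ≤ n) ×
  ((a : Fin p) (b : Fin q) → entry X (i + toℕ a) (j + toℕ b) ≡ just (lookup (lookup Q a) b))

IsPatternOf : {X : Set} {p q m n : ℕ} → Mat X p q → Mat X m n → Set
IsPatternOf Q X = ∃ λ i → ∃ λ j → OccursAt Q X i j

-- Q ∈ P(S, p×q) = ⋃_k P(φ(T_k), p×q)
InS : {p q : ℕ} → Mat Sym p q → Set
InS Q = ∃ λ k → IsPatternOf Q (ST k)

PatternCount : ℕ → ℕ → Set
PatternCount n c =
  Σ (List (Mat Sym n n)) λ xs →
    Unique xs × ((Q : Mat Sym n n) → (Q ∈ xs ⇔ InS Q)) × (length xs ≡ c)

{-# OPTIONS --safe #-}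
module Submission where

-- Split each symbol of S into a horizontal and a vertical crease bit. At an odd column j the horizontal bit is the
-- parity of ⌊i/2⌋ + ⌊j/2⌋, and at an even column it is the horizontal bit at (⌊i/2⌋ , ⌊j/2⌋); the vertical bit obeys
-- a dual rule on the rows. Let 2^k be the least power of two that is at least n. An n × n window meets at most one
-- corner of the grid of aligned 2^k × 2^k blocks, so it is determined by the position of its own corner modulo 2^k
-- and by six bits: two parities of the block position, and the four creases meeting at the corner of the grid.
-- The folding rule, which contains Maekawa's condition on the four creases, admits 20 of the 64 combinations, and all
-- of them occur. Conversely, for n ≥ 3 the window determines its position modulo 2^k, bit by bit, and exactly those of
-- the six bits whose cells it meets. Summing the number of visible combinations over all positions modulo 2^k gives A_n.

open import Defs
open import Data.Bool using (Bool; true; false; not; _xor_; _∧_; _∨_; if_then_else_)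
import Data.Bool.Properties as Boolₚ
open import Data.Bool.Properties using (not-involutive; xor-assoc; xor-comm; xor-same; xor-identityʳ; ∨-zeroʳ)
open import Data.Empty using (⊥; ⊥-elim)
open import Data.Fin using (Fin; toℕ; fromℕ<; #_)
open import Data.Fin.Properties using (toℕ<n; toℕ-fromℕ<)
open import Data.List using (List; []; _∷_; map; filter; deduplicate; length; concatMap; upTo; applyUpTo)
open import Data.List using (cartesianProduct; cartesianProductWith)
open import Data.List.Membership.Propositional using (_∈_; find; lose)
open import Data.List.Membership.Propositional.Properties
open import Data.List.Properties using (length-map; length-++)
import Data.List.Relation.Unary.All as All
import Data.List.Relation.Unary.All.Properties as Allₚ
import Data.List.Relation.Unary.AllPairs as AllPairs
import Data.List.Relation.Unary.AllPairs.Properties as AllPairsₚ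
open import Data.List.Relation.Unary.Any using (here; there)
open import Data.List.Relation.Unary.Unique.DecPropositional.Properties using (deduplicate-!)
open import Data.List.Relation.Unary.Unique.Propositional using (Unique)
import Data.List.Relation.Unary.Unique.Propositional.Properties as Uniqueₚ
open import Data.Maybe as Maybe using (just)
open import Data.Maybe.Properties using (just-injective)
open import Data.Nat
open import Data.Nat.DivMod using ([m+kn]%n≡m%n; m<n⇒m%n≡m; m≡m%n+[m/n]*n; m%n<n)
open import Data.Nat.Induction using (<-rec)
open import Data.Nat.Logarithm using (⌊log₂_⌋; ⌊log₂⌋-mono-≤; ⌊log₂⌊n/2⌋⌋≡⌊log₂n⌋∸1)
open import Data.Nat.Properties
open import Data.Nat.Tactic.RingSolver using (solve; solve-∀)
open import Data.Product using (∃; _×_; _,_; proj₁; proj₂)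
open import Data.Product.Properties using () renaming (≡-dec to ×-≡-dec)
open import Data.Sum using (_⊎_; inj₁; inj₂)
open import Data.Vec as Vec using (Vec; concat; lookup; tabulate)
open import Data.Vec.Properties using (≡-dec; lookup∘tabulate; tabulate∘lookup; tabulate-cong)
open import Function.Bundles using (_⇔_; mk⇔)
open import Relation.Binary using (DecidableEquality)
open import Relation.Binary.PropositionalEquality hiding (J)
open import Relation.Nullary using (Dec; yes; does; contradiction)
open import Relation.Nullary.Decidable using (dec-true; dec-false; map′)

-- The 2-adic valuation of an index decides what it shows. After m steps of the rule, a column
-- divisible by 2^m repeats a column of the coarse plane, and a column of smaller valuation k shows
-- bits of the indices only, bit k + 1 being the highest. Hence only valuation m - 1 sees anything
-- beyond the position modulo 2^m, namely one parity. Rows obey the same law with i + 1 in place of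
-- i; this offset explains the asymmetric bounds for rows and columns. The coarse planes stay
-- arbitrary parameters, so a genuine window can be compared with one over artificial planes built
-- from six bits. What remains is finite and is settled by evaluation: the 20 codes, an occurrence
-- of each, and the number of codes distinguishable under each visibility pattern. The condition n ≥
-- 3 comes from the lowest bit. Three adjacent columns are needed to tell even rows from odd ones.
-- For n = 2 the sum over positions would give 76, but some patterns occur at several positions and
-- only 68 are distinct.

odd : ℕ → Bool
odd zero    = false
odd (suc n) = not (odd n)

not-xor : ∀ a b → not a xor b ≡ not (a xor b)
not-xor true  b = sym (not-involutive b)
not-xor false b = refl

xor-not : ∀ a b → a xor not b ≡ not (a xor b)
xor-not true  b = refl
xor-not false b = refl

odd-+ : ∀ m n → odd (m + n) ≡ odd m xor odd n
odd-+ zero    n = refl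
odd-+ (suc m) n = trans (cong not (odd-+ m n)) (sym (not-xor (odd m) (odd n)))

odd-2* : ∀ m → odd (2 * m) ≡ false
odd-2* m rewrite +-identityʳ m = trans (odd-+ m m) (xor-same (odd m))

half-2* : ∀ m → ⌊ 2 * m /2⌋ ≡ m
half-2* m rewrite +-identityʳ m = sym (n≡⌊n+n/2⌋ m)

half-+2* : ∀ c m → ⌊ c + 2 * m /2⌋ ≡ ⌊ c /2⌋ + m
half-+2* zero          m = half-2* m
half-+2* (suc zero)    m rewrite +-identityʳ m = sym (n≡⌈n+n/2⌉ m)
half-+2* (suc (suc c)) m = cong suc (half-+2* c m)

half-shift : ∀ k c t → ⌊ c + 2 ^ suc k * t /2⌋ ≡ ⌊ c /2⌋ + 2 ^ k * t
half-shift k c t rewrite *-assoc 2 (2 ^ k) t = half-+2* c (2 ^ k * t)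

odd-shift : ∀ k c t → odd (c + 2 ^ suc k * t) ≡ odd c
odd-shift k c t rewrite *-assoc 2 (2 ^ k) t | odd-+ c (2 * (2 ^ k * t)) | odd-2* (2 ^ k * t) = xor-identityʳ (odd c)

half-suc-even : ∀ j → odd j ≡ false → ⌊ suc j /2⌋ ≡ ⌊ j /2⌋
half-suc-even zero          e = refl
half-suc-even (suc zero)    ()
half-suc-even (suc (suc j)) e = cong suc (half-suc-even j (trans (sym (not-involutive (odd j))) e))

half-suc-odd : ∀ j → odd j ≡ true → ⌊ suc j /2⌋ ≡ suc ⌊ j /2⌋
half-suc-odd (suc zero)    e = refl
half-suc-odd (suc (suc j)) e = cong suc (half-suc-odd j (trans (sym (not-involutive (odd j))) e))

even-split : ∀ j → odd j ≡ false → j ≡ 2 * ⌊ j /2⌋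
even-split j e = begin
  j                        ≡⟨ ⌊n/2⌋+⌈n/2⌉≡n j ⟨
  ⌊ j /2⌋ + ⌊ suc j /2⌋    ≡⟨ cong (⌊ j /2⌋ +_) (half-suc-even j e) ⟩
  ⌊ j /2⌋ + ⌊ j /2⌋        ≡⟨ cong (⌊ j /2⌋ +_) (+-identityʳ _) ⟨
  2 * ⌊ j /2⌋              ∎
  where open ≡-Reasoning

odd-split : ∀ j → odd j ≡ true → j ≡ suc (2 * ⌊ j /2⌋)
odd-split j e = begin
  j                          ≡⟨ ⌊n/2⌋+⌈n/2⌉≡n j ⟨
  ⌊ j /2⌋ + ⌊ suc j /2⌋      ≡⟨ cong (⌊ j /2⌋ +_) (half-suc-odd j e) ⟩
  ⌊ j /2⌋ + suc ⌊ j /2⌋      ≡⟨ +-suc _ _ ⟩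
  suc (⌊ j /2⌋ + ⌊ j /2⌋)    ≡⟨ cong (λ m → suc (⌊ j /2⌋ + m)) (+-identityʳ _) ⟨
  suc (2 * ⌊ j /2⌋)          ∎
  where open ≡-Reasoning

half-< : ∀ {n m} → n < 2 * m → ⌊ n /2⌋ < m
half-< {n} {m} n<2m = *-cancelˡ-< 2 _ _ (≤-<-trans lem n<2m)
  where
  lem : 2 * ⌊ n /2⌋ ≤ n
  lem = begin
    2 * ⌊ n /2⌋              ≡⟨ cong (⌊ n /2⌋ +_) (+-identityʳ _) ⟩
    ⌊ n /2⌋ + ⌊ n /2⌋        ≤⟨ +-monoʳ-≤ ⌊ n /2⌋ (⌊n/2⌋≤⌈n/2⌉ n) ⟩
    ⌊ n /2⌋ + ⌈ n /2⌉        ≡⟨ ⌊n/2⌋+⌈n/2⌉≡n n ⟩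
    n                        ∎
    where open ≤-Reasoning

≤half⇒2*≤ : ∀ {x g} → g ≤ ⌊ x /2⌋ → 2 * g ≤ x
≤half⇒2*≤ {x} {g} g≤ = ≮⇒≥ λ x<2g → <⇒≱ (half-< {x} {g} x<2g) g≤

half<⇒<2* : ∀ {x g} → ⌊ x /2⌋ < g → x < 2 * g
half<⇒<2* {x} {g} <g = ≰⇒> λ 2g≤x → <⇒≱ <g (subst (_≤ ⌊ x /2⌋) (half-2* g) (⌊n/2⌋-mono 2g≤x))

-- The folding rule on crease planes, and closed forms for its iterates

Plane : Set
Plane = ℕ → ℕ → Bool

hE : Plane → Plane
hE h i j = if odd j then odd ⌊ i /2⌋ xor odd ⌊ j /2⌋ else h ⌊ i /2⌋ ⌊ j /2⌋

vE : Plane → Plane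
vE v i j = if odd i then v ⌊ i /2⌋ ⌊ j /2⌋ else odd ⌊ i /2⌋ xor odd j

hE^ : ℕ → Plane → Plane
hE^ zero    h = h
hE^ (suc k) h = hE (hE^ k h)

vE^ : ℕ → Plane → Plane
vE^ zero    v = v
vE^ (suc k) v = vE (vE^ k v)

module _ (h : Plane) where

  hE-odd : ∀ i j → odd j ≡ true → hE h i j ≡ odd ⌊ i /2⌋ xor odd ⌊ j /2⌋
  hE-odd i j e rewrite e = refl

  hE-even : ∀ i j → odd j ≡ false → hE h i j ≡ h ⌊ i /2⌋ ⌊ j /2⌋
  hE-even i j e rewrite e = refl

  hE-row-pair : ∀ i j → odd i ≡ false → hE h (suc i) j ≡ hE h i j
  hE-row-pair i j e rewrite half-suc-even i e = refl

  hE-flip : ∀ i j → odd i ≡ true → odd j ≡ true → hE h (suc i) j ≡ not (hE h i j)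
  hE-flip i j e e′ rewrite e′ | half-suc-odd i e = not-xor (odd ⌊ i /2⌋) _

module _ (v : Plane) where

  vE-even : ∀ i j → odd i ≡ false → vE v i j ≡ odd ⌊ i /2⌋ xor odd j
  vE-even i j e rewrite e = refl

  vE-odd : ∀ i j → odd i ≡ true → vE v i j ≡ v ⌊ i /2⌋ ⌊ j /2⌋
  vE-odd i j e rewrite e = refl

  vE-col-pair : ∀ i j → odd i ≡ true → odd j ≡ false → vE v i (suc j) ≡ vE v i j
  vE-col-pair i j e e′ rewrite e | half-suc-even j e′ = refl

  vE-flip : ∀ i j → odd i ≡ false → vE v i (suc j) ≡ not (vE v i j)
  vE-flip i j e rewrite e = xor-not (odd ⌊ i /2⌋) (odd j)

-- 2 ^ k - 1, the last row of an aligned block of height 2 ^ k.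
ρ : ℕ → ℕ
ρ zero    = 0
ρ (suc k) = suc (2 * ρ k)

suc-ρ : ∀ k → suc (ρ k) ≡ 2 ^ k
suc-ρ zero    = refl
suc-ρ (suc k) = begin
  suc (suc (2 * ρ k))  ≡⟨ *-suc 2 (ρ k) ⟨
  2 * suc (ρ k)        ≡⟨ cong (2 *_) (suc-ρ k) ⟩
  2 * 2 ^ k            ∎
  where open ≡-Reasoning

ρ< : ∀ k → ρ k < 2 ^ k
ρ< k = ≤-reflexive (suc-ρ k)

-- Bit k + 1 and bit k of c respectively: the part of a reading at level k that comes from the low
-- bits of the other coordinate.
hbit vbit : ℕ → ℕ → Bool
hbit zero    c = odd ⌊ c /2⌋
hbit (suc k) c = hbit k ⌊ c /2⌋
vbit zero    c = odd c
vbit (suc k) c = vbit k ⌊ c /2⌋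

-- The column is 2^k times an odd number: k halvings find it even and pass to the coarser plane, and
-- the next finds it odd, where the rule stops without consulting `h`.
hE^-read : ∀ {k m} h c t q → k < m →
  hE^ m h (c + 2 ^ suc k * t) (2 ^ k + 2 ^ suc k * q) ≡ (odd t xor odd q) xor hbit k c
hE^-read {zero} {suc m} h c t q (s≤s _) = begin
  hE (hE^ m h) (c + 2 * t) (1 + 2 * q)
    ≡⟨ hE-odd (hE^ m h) (c + 2 * t) (1 + 2 * q) (cong not (odd-2* q)) ⟩
  odd ⌊ c + 2 * t /2⌋ xor odd ⌊ 1 + 2 * q /2⌋
    ≡⟨ cong₂ (λ a b → odd a xor odd b) (half-+2* c t) (half-+2* 1 q) ⟩
  odd (⌊ c /2⌋ + t) xor odd q
    ≡⟨ cong (_xor odd q) (odd-+ ⌊ c /2⌋ t) ⟩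
  (odd ⌊ c /2⌋ xor odd t) xor odd q
    ≡⟨ xor-assoc (odd ⌊ c /2⌋) _ _ ⟩
  odd ⌊ c /2⌋ xor (odd t xor odd q)
    ≡⟨ xor-comm (odd ⌊ c /2⌋) _ ⟩
  (odd t xor odd q) xor odd ⌊ c /2⌋ ∎
  where open ≡-Reasoning
hE^-read {suc k} {suc m} h c t q (s≤s k<m) = begin
  hE (hE^ m h) (c + 2 ^ suc (suc k) * t) (2 ^ suc k + 2 ^ suc (suc k) * q)
    ≡⟨ hE-even (hE^ m h) (c + 2 ^ suc (suc k) * t) (2 ^ suc k + 2 ^ suc (suc k) * q)
         (trans (odd-shift (suc k) (2 ^ suc k) q) (odd-2* (2 ^ k))) ⟩
  hE^ m h ⌊ c + 2 ^ suc (suc k) * t /2⌋ ⌊ 2 ^ suc k + 2 ^ suc (suc k) * q /2⌋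
    ≡⟨ cong₂ (hE^ m h) (half-shift (suc k) c t)
         (trans (half-shift (suc k) (2 ^ suc k) q) (cong (_+ 2 ^ suc k * q) (half-2* (2 ^ k)))) ⟩
  hE^ m h (⌊ c /2⌋ + 2 ^ suc k * t) (2 ^ k + 2 ^ suc k * q)
    ≡⟨ hE^-read h ⌊ c /2⌋ t q k<m ⟩
  (odd t xor odd q) xor hbit k ⌊ c /2⌋ ∎
  where open ≡-Reasoning

-- Here the rule descends on odd rows and stops on even ones. A row is odd for exactly k halvings
-- when its successor is 2^k times an odd number, whence `ρ k`.
vE^-read : ∀ {k m} v t c s → k < m →
  vE^ m v (ρ k + 2 ^ suc k * t) (c + 2 ^ suc k * s) ≡ odd t xor vbit k c
vE^-read {zero} {suc m} v t c s (s≤s _) = begin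
  vE (vE^ m v) (2 * t) (c + 2 * s)
    ≡⟨ vE-even (vE^ m v) (2 * t) (c + 2 * s) (odd-2* t) ⟩
  odd ⌊ 2 * t /2⌋ xor odd (c + 2 * s)
    ≡⟨ cong₂ _xor_ (cong odd (half-2* t)) (odd-shift 0 c s) ⟩
  odd t xor odd c ∎
  where open ≡-Reasoning
vE^-read {suc k} {suc m} v t c s (s≤s k<m) = begin
  vE (vE^ m v) (ρ (suc k) + 2 ^ suc (suc k) * t) (c + 2 ^ suc (suc k) * s)
    ≡⟨ vE-odd (vE^ m v) (ρ (suc k) + 2 ^ suc (suc k) * t) (c + 2 ^ suc (suc k) * s)
         (trans (odd-shift (suc k) (ρ (suc k)) t) (cong not (odd-2* (ρ k)))) ⟩
  vE^ m v ⌊ ρ (suc k) + 2 ^ suc (suc k) * t /2⌋ ⌊ c + 2 ^ suc (suc k) * s /2⌋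
    ≡⟨ cong₂ (vE^ m v)
         (trans (half-shift (suc k) (ρ (suc k)) t) (cong (_+ 2 ^ suc k * t) (half-+2* 1 (ρ k))))
         (half-shift (suc k) c s) ⟩
  vE^ m v (ρ k + 2 ^ suc k * t) (⌊ c /2⌋ + 2 ^ suc k * s)
    ≡⟨ vE^-read v t ⌊ c /2⌋ s k<m ⟩
  odd t xor vbit k ⌊ c /2⌋ ∎
  where open ≡-Reasoning

-- A multiple of 2^m is even at each of the m halvings, so the rule descends all the way to `h`.
hE^-block : ∀ m h c t e → c < 2 ^ m → hE^ m h (c + 2 ^ m * t) (2 ^ m * e) ≡ h t e
hE^-block zero    h zero t e _ = cong₂ h (+-identityʳ t) (+-identityʳ e)
hE^-block zero    h (suc c) t e (s≤s ())
hE^-block (suc m) h c t e c<W = begin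
  hE (hE^ m h) (c + 2 ^ suc m * t) (2 ^ suc m * e)
    ≡⟨ hE-even (hE^ m h) (c + 2 ^ suc m * t) (2 ^ suc m * e) (odd-shift m 0 e) ⟩
  hE^ m h ⌊ c + 2 ^ suc m * t /2⌋ ⌊ 2 ^ suc m * e /2⌋
    ≡⟨ cong₂ (hE^ m h) (half-shift m c t) (half-shift m 0 e) ⟩
  hE^ m h (⌊ c /2⌋ + 2 ^ m * t) (2 ^ m * e)
    ≡⟨ hE^-block m h ⌊ c /2⌋ t e (half-< c<W) ⟩
  h t e ∎
  where open ≡-Reasoning

vE^-block : ∀ m v t c e → c < 2 ^ m → vE^ m v (ρ m + 2 ^ m * t) (c + 2 ^ m * e) ≡ v t e
vE^-block zero    v t zero e _ = cong₂ v (+-identityʳ t) (+-identityʳ e)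
vE^-block zero    v t (suc c) e (s≤s ())
vE^-block (suc m) v t c e c<W = begin
  vE (vE^ m v) (ρ (suc m) + 2 ^ suc m * t) (c + 2 ^ suc m * e)
    ≡⟨ vE-odd (vE^ m v) (ρ (suc m) + 2 ^ suc m * t) (c + 2 ^ suc m * e)
         (trans (odd-shift m (ρ (suc m)) t) (cong not (odd-2* (ρ m)))) ⟩
  vE^ m v ⌊ ρ (suc m) + 2 ^ suc m * t /2⌋ ⌊ c + 2 ^ suc m * e /2⌋
    ≡⟨ cong₂ (vE^ m v)
         (trans (half-shift m (ρ (suc m)) t) (cong (_+ 2 ^ m * t) (half-+2* 1 (ρ m))))
         (half-shift m c e) ⟩
  vE^ m v (ρ m + 2 ^ m * t) (⌊ c /2⌋ + 2 ^ m * e)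
    ≡⟨ vE^-block m v t ⌊ c /2⌋ e (half-< c<W) ⟩
  v t e ∎
  where open ≡-Reasoning

-- The planes belong to the site so that windows over different planes can be compared, in
-- particular with the artificial ones of `siteOf`.
record Site : Set where
  constructor site
  field
    hor ver : Plane
    row col : ℕ
open Site

Same : ℕ → Site → Site → Set
Same n p p′ = ∀ r c → r < n → c < n →
  (hor p (r + row p) (c + col p) ≡ hor p′ (r + row p′) (c + col p′)) ×
  (ver p (r + row p) (c + col p) ≡ ver p′ (r + row p′) (c + col p′))

Same-sym : ∀ {n p p′} → Same n p p′ → Same n p′ p
Same-sym s r c r< c< = sym (proj₁ (s r c r< c<)) , sym (proj₂ (s r c r< c<))

not-fixed : ∀ {b} → not b ≢ b
not-fixed {true}  ()
not-fixed {false} ()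

true-or-false : ∀ b → b ≡ true ⊎ b ≡ false
true-or-false true  = inj₁ refl
true-or-false false = inj₂ refl

-- Parity of the position

-- Along an even row the vertical bit alternates at every step; along an odd row it repeats on
-- columns 2J and 2J + 1. Any three consecutive columns contain such a pair; two need not.
row-clash : ∀ {v v′ i j i′ j′} → odd i ≡ false → odd i′ ≡ true →
  (∀ c → c < 3 → vE v i (c + j) ≡ vE v′ i′ (c + j′)) → ⊥
row-clash {v} {v′} {i} {j} {i′} {j′} ei oi′ eq with odd j′ in ej
... | false = not-fixed (begin
    not (vE v i j)     ≡⟨ vE-flip v i j ei ⟨
    vE v i (suc j)     ≡⟨ eq 1 (s≤s (s≤s z≤n)) ⟩
    vE v′ i′ (suc j′)  ≡⟨ vE-col-pair v′ i′ j′ oi′ ej ⟩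
    vE v′ i′ j′        ≡⟨ eq 0 (s≤s z≤n) ⟨
    vE v i j           ∎)
  where open ≡-Reasoning
... | true = not-fixed (begin
    not (vE v i (suc j))     ≡⟨ vE-flip v i (suc j) ei ⟨
    vE v i (2 + j)           ≡⟨ eq 2 ≤-refl ⟩
    vE v′ i′ (2 + j′)        ≡⟨ vE-col-pair v′ i′ (suc j′) oi′ (cong not ej) ⟩
    vE v′ i′ (suc j′)        ≡⟨ eq 1 (s≤s (s≤s z≤n)) ⟨
    vE v i (suc j)           ∎)
  where open ≡-Reasoning

-- A horizontal crease changes sign across the rows 2I+1, 2I+2 only if I is odd, unless its column is odd.
flip⇒odd : ∀ {h h′ i j i′ j′} → odd i ≡ true → odd i′ ≡ true → odd j ≡ false → odd j′ ≡ true →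
  hE (hE h) i j ≡ hE h′ i′ j′ → hE (hE h) (suc i) j ≡ hE h′ (suc i′) j′ → odd ⌊ i /2⌋ ≡ true
flip⇒odd {h} {h′} {i} {j} {i′} {j′} oi oi′ ej oj′ eq₀ eq₁ with true-or-false (odd ⌊ i /2⌋)
... | inj₁ e = e
... | inj₂ e = ⊥-elim (not-fixed (begin
    not (hE h′ i′ j′)              ≡⟨ hE-flip h′ i′ j′ oi′ oj′ ⟨
    hE h′ (suc i′) j′              ≡⟨ eq₁ ⟨
    hE (hE h) (suc i) j            ≡⟨ hE-even (hE h) (suc i) j ej ⟩
    hE h ⌊ suc i /2⌋ ⌊ j /2⌋       ≡⟨ cong (λ a → hE h a ⌊ j /2⌋) (half-suc-odd i oi) ⟩
    hE h (suc ⌊ i /2⌋) ⌊ j /2⌋     ≡⟨ hE-row-pair h ⌊ i /2⌋ ⌊ j /2⌋ e ⟩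
    hE h ⌊ i /2⌋ ⌊ j /2⌋           ≡⟨ hE-even (hE h) i j ej ⟨
    hE (hE h) i j                  ≡⟨ eq₀ ⟩
    hE h′ i′ j′                    ∎))
  where open ≡-Reasoning

-- Of each two adjacent columns one is even, so `flip⇒odd`, used once in each direction, makes both
-- halved rows odd. Then the next row has an even half on both sides, its vertical bit is the bare
-- parity of the column, and the two parities differ.
col-clash : ∀ {h h′ v v′ i j i′ j′} → odd i ≡ true → odd i′ ≡ true → odd j ≡ false → odd j′ ≡ true →
  Same 2 (site (hE (hE h)) (vE v) i j) (site (hE (hE h′)) (vE v′) i′ j′) → ⊥
col-clash {h} {h′} {v} {v′} {i} {j} {i′} {j′} oi oi′ ej oj′ eq = contradiction (begin
    false                            ≡⟨ cong₂ (λ a b → not a xor b) oI ej ⟨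
    odd (suc ⌊ i /2⌋) xor odd j      ≡⟨ cong (λ a → odd a xor odd j) (half-suc-odd i oi) ⟨
    odd ⌊ suc i /2⌋ xor odd j        ≡⟨ vE-even v (suc i) j (cong not oi) ⟨
    vE v (suc i) j                   ≡⟨ proj₂ (eq 1 0 ≤-refl (s≤s z≤n)) ⟩
    vE v′ (suc i′) j′                ≡⟨ vE-even v′ (suc i′) j′ (cong not oi′) ⟩
    odd ⌊ suc i′ /2⌋ xor odd j′      ≡⟨ cong (λ a → odd a xor odd j′) (half-suc-odd i′ oi′) ⟩
    odd (suc ⌊ i′ /2⌋) xor odd j′    ≡⟨ cong₂ (λ a b → not a xor b) oI′ oj′ ⟩
    true                             ∎) (λ ())
  where
  open ≡-Reasoning
  oI : odd ⌊ i /2⌋ ≡ true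
  oI = flip⇒odd {h} {hE h′} {i} {j} {i′} {j′} oi oi′ ej oj′
         (proj₁ (eq 0 0 (s≤s z≤n) (s≤s z≤n))) (proj₁ (eq 1 0 ≤-refl (s≤s z≤n)))
  oI′ : odd ⌊ i′ /2⌋ ≡ true
  oI′ = flip⇒odd {h′} {hE h} {i′} {suc j′} {i} {suc j} oi′ oi (cong not oj′) (cong not ej)
         (sym (proj₁ (eq 0 1 (s≤s z≤n) ≤-refl))) (sym (proj₁ (eq 1 1 ≤-refl ≤-refl)))

module _ {n} (3≤n : 3 ≤ n) where

  row-parity : ∀ h h′ v v′ {i j i′ j′} →
    Same n (site h (vE v) i j) (site h′ (vE v′) i′ j′) → odd i ≡ odd i′
  row-parity h h′ v v′ {i} {j} {i′} {j′} same with odd i in e | odd i′ in e′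
  ... | true  | true  = refl
  ... | false | false = refl
  ... | false | true  = ⊥-elim (row-clash {v} {v′} {i} {j} {i′} {j′} e e′
                          λ c c<3 → proj₂ (same 0 c (≤-trans (s≤s z≤n) 3≤n) (≤-trans c<3 3≤n)))
  ... | true  | false = ⊥-elim (row-clash {v′} {v} {i′} {j′} {i} {j} e′ e
                          λ c c<3 → sym (proj₂ (same 0 c (≤-trans (s≤s z≤n) 3≤n) (≤-trans c<3 3≤n))))

  -- The clash needs an odd row followed by an even one. A window that starts on an even row
  -- supplies them as its second and third rows.
  col-parity-clash : ∀ h h′ v v′ {i j i′ j′} → odd i ≡ odd i′ → odd j ≡ false → odd j′ ≡ true →
    Same n (site (hE (hE h)) (vE v) i j) (site (hE (hE h′)) (vE v′) i′ j′) → ⊥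
  col-parity-clash h h′ v v′ {i} {j} {i′} {j′} pi ej oj′ same with odd i in e
  ... | true = col-clash {h} {h′} {v} {v′} {i} {j} {i′} {j′} e (sym pi) ej oj′
                 (λ r c r<2 c<2 → same r c (≤-trans (m≤n⇒m≤1+n r<2) 3≤n) (≤-trans (m≤n⇒m≤1+n c<2) 3≤n))
  ... | false = col-clash {h} {h′} {v} {v′} {suc i} {j} {suc i′} {j′} (cong not e) (cong not (sym pi)) ej oj′ shifted
    where
    shifted : Same 2 (site (hE (hE h)) (vE v) (suc i) j) (site (hE (hE h′)) (vE v′) (suc i′) j′)
    shifted r c r<2 c<2 rewrite +-suc r i | +-suc r i′ =
      same (suc r) c (≤-trans (s≤s r<2) 3≤n) (≤-trans (m≤n⇒m≤1+n c<2) 3≤n)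

  col-parity : ∀ h h′ v v′ {i j i′ j′} → odd i ≡ odd i′ →
    Same n (site (hE (hE h)) (vE v) i j) (site (hE (hE h′)) (vE v′) i′ j′) → odd j ≡ odd j′
  col-parity h h′ v v′ {i} {j} {i′} {j′} pi same with odd j in e | odd j′ in e′
  ... | true  | true  = refl
  ... | false | false = refl
  ... | false | true  = ⊥-elim (col-parity-clash h h′ v v′ pi e e′ same)
  ... | true  | false = ⊥-elim (col-parity-clash h′ h v′ v (sym pi) e′ e
                          (Same-sym {n} {site (hE (hE h)) (vE v) i j} {site (hE (hE h′)) (vE v′) i′ j′} same))

-- Position modulo powers of two

-- The common part c need not be reduced. Both indices come out in the shape that the reading lemmas
-- expect.
Cong : ℕ → ℕ → ℕ → Set
Cong k i i′ = ∃ λ c → ∃ λ t → ∃ λ t′ → (i ≡ c + 2 ^ k * t) × (i′ ≡ c + 2 ^ k * t′)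

parity-split : ∀ t t′ → odd t ≡ odd t′ → ∃ λ e → ∃ λ f → ∃ λ f′ → (t ≡ e + 2 * f) × (t′ ≡ e + 2 * f′)
parity-split t t′ eq with true-or-false (odd t)
... | inj₁ o = 1 , ⌊ t /2⌋ , ⌊ t′ /2⌋ , odd-split t o , odd-split t′ (trans (sym eq) o)
... | inj₂ o = 0 , ⌊ t /2⌋ , ⌊ t′ /2⌋ , even-split t o , even-split t′ (trans (sym eq) o)

Cong-refine : ∀ k c {i i′} t t′ → i ≡ c + 2 ^ k * t → i′ ≡ c + 2 ^ k * t′ → odd t ≡ odd t′ → Cong (suc k) i i′
Cong-refine k c t t′ refl refl eq with parity-split t t′ eq
... | e , f , f′ , refl , refl = c + 2 ^ k * e , f , f′ , distr f , distr f′
  where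
  distr : ∀ f → c + 2 ^ k * (e + 2 * f) ≡ c + 2 ^ k * e + 2 ^ suc k * f
  distr f = lemma c (2 ^ k) e f
    where
    lemma : ∀ c q e f → c + q * (e + 2 * f) ≡ c + q * e + 2 * q * f
    lemma = solve-∀

offset-to : ∀ k c g → g < 2 ^ k → ∃ λ r → ∃ λ d → r < 2 ^ k × r + c ≡ g + 2 ^ k * d
offset-to k zero    g g< = g , 0 , g< , cong (g +_) (sym (*-zeroʳ (2 ^ k)))
offset-to k (suc c) g g< with offset-to k c g g<
... | suc r , d , r< , eq = r , d , <-trans ≤-refl r< , trans (+-suc r c) eq
-- The start has just passed the target, so the next hit is the last offset of the period, one
-- period later.
... | zero  , d , r< , eq = ρ k , suc d , ρ< k , (begin
    ρ k + suc c                  ≡⟨ +-suc (ρ k) c ⟩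
    suc (ρ k) + c                ≡⟨ cong₂ _+_ (suc-ρ k) eq ⟩
    2 ^ k + (g + 2 ^ k * d)      ≡⟨ lemma (2 ^ k) g d ⟩
    g + 2 ^ k * suc d            ∎)
  where
  open ≡-Reasoning
  lemma : ∀ q g d → q + (g + q * d) ≡ g + q * suc d
  lemma = solve-∀

xor-cancelˡ : ∀ a {b c} → a xor b ≡ a xor c → b ≡ c
xor-cancelˡ false eq = eq
xor-cancelˡ true {b} {c} eq = trans (sym (not-involutive b)) (trans (cong not eq) (not-involutive c))

xor-cancelʳ : ∀ a {b c} → b xor a ≡ c xor a → b ≡ c
xor-cancelʳ a {b} {c} eq = xor-cancelˡ a (trans (xor-comm a b) (trans eq (xor-comm c a)))

odd-+-cancelˡ : ∀ d {t t′} → odd (d + t) ≡ odd (d + t′) → odd t ≡ odd t′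
odd-+-cancelˡ d {t} {t′} eq = xor-cancelˡ (odd d) (trans (sym (odd-+ d t)) (trans eq (odd-+ d t′)))

regroup : ∀ k r c {g d} t → r + c ≡ g + 2 ^ k * d → r + (c + 2 ^ k * t) ≡ g + 2 ^ k * (d + t)
regroup k r c {g} {d} t eq = begin
  r + (c + 2 ^ k * t)          ≡⟨ +-assoc r c _ ⟨
  r + c + 2 ^ k * t            ≡⟨ cong (_+ 2 ^ k * t) eq ⟩
  g + 2 ^ k * d + 2 ^ k * t    ≡⟨ lemma (2 ^ k) g d t ⟩
  g + 2 ^ k * (d + t)          ∎
  where
  open ≡-Reasoning
  lemma : ∀ q g d t → g + q * d + q * t ≡ g + q * (d + t)
  lemma = solve-∀

<2^suc : ∀ k → 2 ^ k < 2 ^ suc k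
<2^suc k = m<m+n (2 ^ k) (subst (0 <_) (sym (+-identityʳ _)) (m^n>0 2 k))

module _ {m n : ℕ} (h h′ v v′ : Plane) {i j i′ j′}
  (same : Same n (site (hE^ m h) (vE^ m v) i j) (site (hE^ m h′) (vE^ m v′) i′ j′)) where

  -- Some row r of the window has r + 1 ≡ 2 ^ k modulo 2 ^ (k + 1); its creases reveal the next bit of r.
  row-step : ∀ k → k < m → 2 ^ suc k ≤ n → Cong (suc k) i i′ → Cong (suc k) j j′ → Cong (suc (suc k)) i i′
  row-step k k<m k≤n (c , t , t′ , refl , refl) (e , s , s′ , refl , refl)
    with offset-to (suc k) c (ρ k) (<-trans (ρ< k) (<2^suc k))
  ... | r , d , r< , eq = Cong-refine (suc k) c t t′ refl refl
          (odd-+-cancelˡ d (xor-cancelʳ (vbit k e) (begin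
    odd (d + t) xor vbit k e
      ≡⟨ vE^-read v (d + t) e s k<m ⟨
    vE^ m v (ρ k + 2 ^ suc k * (d + t)) (e + 2 ^ suc k * s)
      ≡⟨ cong (λ a → vE^ m v a (e + 2 ^ suc k * s)) (regroup (suc k) r c t eq) ⟨
    vE^ m v (r + (c + 2 ^ suc k * t)) (e + 2 ^ suc k * s)
      ≡⟨ proj₂ (same r 0 (≤-trans r< k≤n) (≤-trans (m^n>0 2 (suc k)) k≤n)) ⟩
    vE^ m v′ (r + (c + 2 ^ suc k * t′)) (e + 2 ^ suc k * s′)
      ≡⟨ cong (λ a → vE^ m v′ a (e + 2 ^ suc k * s′)) (regroup (suc k) r c t′ eq) ⟩
    vE^ m v′ (ρ k + 2 ^ suc k * (d + t′)) (e + 2 ^ suc k * s′)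
      ≡⟨ vE^-read v′ (d + t′) e s′ k<m ⟩
    odd (d + t′) xor vbit k e ∎)))
    where open ≡-Reasoning

  -- A horizontal reading at level k mixes bit k + 1 of the column with bit k + 1 of the row, so the
  -- rows must already agree modulo 2^(k+2). This forces the row step to come first.
  col-step : ∀ k → k < m → 2 ^ suc k ≤ n → Cong (suc (suc k)) i i′ → Cong (suc k) j j′ → Cong (suc (suc k)) j j′
  col-step k k<m k≤n (e , s , s′ , refl , refl) (c , t , t′ , refl , refl)
    with offset-to (suc k) c (2 ^ k) (<2^suc k)
  ... | r , d , r< , eq = Cong-refine (suc k) c t t′ refl refl
          (odd-+-cancelˡ d (xor-cancelʳ (hbit k e) (begin
    odd (d + t) xor hbit k e
      ≡⟨ read h s t ⟨
    hE^ m h (e + 2 ^ suc (suc k) * s) (r + (c + 2 ^ suc k * t))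
      ≡⟨ proj₁ (same 0 r (≤-trans (m^n>0 2 (suc k)) k≤n) (≤-trans r< k≤n)) ⟩
    hE^ m h′ (e + 2 ^ suc (suc k) * s′) (r + (c + 2 ^ suc k * t′))
      ≡⟨ read h′ s′ t′ ⟩
    odd (d + t′) xor hbit k e ∎)))
    where
    open ≡-Reasoning
    lemma : ∀ q s → 2 * q * s ≡ q * (2 * s)
    lemma = solve-∀
    read : ∀ h s t → hE^ m h (e + 2 ^ suc (suc k) * s) (r + (c + 2 ^ suc k * t)) ≡ odd (d + t) xor hbit k e
    read h s t = begin
      hE^ m h (e + 2 ^ suc (suc k) * s) (r + (c + 2 ^ suc k * t))
        ≡⟨ cong₂ (hE^ m h) (cong (e +_) (lemma (2 ^ suc k) s)) (regroup (suc k) r c t eq) ⟩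
      -- The row multiplier is written as 2 * s, so that its parity drops out of the reading and the
      -- common `hbit k e` is left to cancel.
      hE^ m h (e + 2 ^ suc k * (2 * s)) (2 ^ k + 2 ^ suc k * (d + t))
        ≡⟨ hE^-read h e (2 * s) (d + t) k<m ⟩
      (odd (2 * s) xor odd (d + t)) xor hbit k e
        ≡⟨ cong (λ b → (b xor odd (d + t)) xor hbit k e) (odd-2* s) ⟩
      odd (d + t) xor hbit k e ∎

module _ {m n : ℕ} (h h′ v v′ : Plane) {i j i′ j′} (3≤n : 3 ≤ n)
  (same : Same n (site (hE^ (2 + m) h) (vE^ (2 + m) v) i j) (site (hE^ (2 + m) h′) (vE^ (2 + m) v′) i′ j′)) where

  position-mod : ∀ k → k < 2 + m → 2 ^ k ≤ n → Cong (suc k) i i′ × Cong (suc k) j j′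
  position-mod zero _ _ =
    Cong-refine 0 0 i i′ (sym (+-identityʳ i)) (sym (+-identityʳ i′)) pi ,
    Cong-refine 0 0 j j′ (sym (+-identityʳ j)) (sym (+-identityʳ j′))
      (col-parity 3≤n (hE^ m h) (hE^ m h′) (vE^ (suc m) v) (vE^ (suc m) v′) pi same)
    where
    pi : odd i ≡ odd i′
    pi = row-parity 3≤n (hE^ (2 + m) h) (hE^ (2 + m) h′) (vE^ (suc m) v) (vE^ (suc m) v′) same
  position-mod (suc k) k<m k≤n
    with position-mod k (<-trans ≤-refl k<m) (≤-trans (<⇒≤ (<2^suc k)) k≤n)
  ... | ci , cj = ci′ , col-step h h′ v v′ same k (<-trans ≤-refl k<m) k≤n ci′ cj
    where ci′ = row-step h h′ v v′ same k (<-trans ≤-refl k<m) k≤n ci cj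

-- What an entry near a grid corner depends on

odd-shift₀ : ∀ c t → odd (c + 1 * t) ≡ odd c xor odd t
odd-shift₀ c t = trans (odd-+ c (1 * t)) (cong (λ i → odd c xor odd i) (+-identityʳ t))

xor-interchange : ∀ a b c d → (a xor b) xor (c xor d) ≡ (a xor c) xor (b xor d)
xor-interchange true  true  true  d = refl
xor-interchange true  true  false d = sym (not-involutive d)
xor-interchange true  false true  d = not-involutive d
xor-interchange true  false false d = refl
xor-interchange false true  true  d = refl
xor-interchange false true  false d = refl
xor-interchange false false c     d = refl

double-< : ∀ {x y} → 0 < x → x ≡ 2 * y → 0 < y
double-< {y = suc y} _ _ = s≤s z≤n
double-< {suc x} {zero} _ ()

-- In the range 0 < y < 2^(m+1) only y = 2^m reaches the coarse plane, and only the two columns of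
-- valuation m - 1 involve a and b, through the parity of a + b. The equation m ≡ suc l avoids a
-- valuation m - 1 when m is 0.
hE^-agree : ∀ m {h h′ a b a′ b′} x y → x < 2 ^ suc m → 0 < y → y < 2 ^ suc m →
  (∀ l → m ≡ suc l → y ≡ 2 ^ l ⊎ y ≡ 2 ^ m + 2 ^ l → odd a xor odd b ≡ odd a′ xor odd b′) →
  (y ≡ 2 ^ m → x < 2 ^ m → h a (suc b) ≡ h′ a′ (suc b′)) →
  (y ≡ 2 ^ m → 2 ^ m ≤ x → h (suc a) (suc b) ≡ h′ (suc a′) (suc b′)) →
  hE^ m h (x + 2 ^ m * a) (y + 2 ^ m * b) ≡ hE^ m h′ (x + 2 ^ m * a′) (y + 2 ^ m * b′)
hE^-agree zero {h} {h′} {a} {b} {a′} {b′} x 1 x< _ _ _ hA hB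
  rewrite +-identityʳ a | +-identityʳ b | +-identityʳ a′ | +-identityʳ b′ with x
... | 0           = hA refl (s≤s z≤n)
... | 1           = hB refl (s≤s z≤n)
... | suc (suc _) = contradiction x< λ { (s≤s (s≤s ())) }
hE^-agree zero x (suc (suc y)) _ _ (s≤s (s≤s ()))
hE^-agree (suc m) {h} {h′} {a} {b} {a′} {b′} x y x< 0<y y< sS hA hB with true-or-false (odd y)
... | inj₁ oy = begin
    hE (hE^ m h) (x + 2 ^ suc m * a) (y + 2 ^ suc m * b)     ≡⟨ unfold h a b ⟩
    odd (⌊ x /2⌋ + 2 ^ m * a) xor odd (⌊ y /2⌋ + 2 ^ m * b)  ≡⟨ indep m y< sS ⟩
    odd (⌊ x /2⌋ + 2 ^ m * a′) xor odd (⌊ y /2⌋ + 2 ^ m * b′) ≡⟨ unfold h′ a′ b′ ⟨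
    hE (hE^ m h′) (x + 2 ^ suc m * a′) (y + 2 ^ suc m * b′)  ∎
  where
  open ≡-Reasoning
  unfold : ∀ h a b → hE (hE^ m h) (x + 2 ^ suc m * a) (y + 2 ^ suc m * b) ≡
                     odd (⌊ x /2⌋ + 2 ^ m * a) xor odd (⌊ y /2⌋ + 2 ^ m * b)
  unfold h a b = trans
    (hE-odd (hE^ m h) (x + 2 ^ suc m * a) (y + 2 ^ suc m * b) (trans (odd-shift m y b) oy))
    (cong₂ (λ i j → odd i xor odd j) (half-shift m x a) (half-shift m y b))
  -- The recursion stops here at an odd column. Unless the block has size 2, the halved indices lose
  -- a and b modulo 2.
  indep : ∀ m → y < 2 ^ suc (suc m) →
    (∀ l → suc m ≡ suc l → y ≡ 2 ^ l ⊎ y ≡ 2 ^ suc m + 2 ^ l → odd a xor odd b ≡ odd a′ xor odd b′) →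
    odd (⌊ x /2⌋ + 2 ^ m * a) xor odd (⌊ y /2⌋ + 2 ^ m * b) ≡
    odd (⌊ x /2⌋ + 2 ^ m * a′) xor odd (⌊ y /2⌋ + 2 ^ m * b′)
  indep (suc m) _ _ = cong₂ _xor_
    (trans (odd-shift m ⌊ x /2⌋ a) (sym (odd-shift m ⌊ x /2⌋ a′)))
    (trans (odd-shift m ⌊ y /2⌋ b) (sym (odd-shift m ⌊ y /2⌋ b′)))
  indep zero y<4 sS = begin
    odd (⌊ x /2⌋ + 1 * a) xor odd (⌊ y /2⌋ + 1 * b)
      ≡⟨ cong₂ _xor_ (odd-shift₀ ⌊ x /2⌋ a) (odd-shift₀ ⌊ y /2⌋ b) ⟩
    (odd ⌊ x /2⌋ xor odd a) xor (odd ⌊ y /2⌋ xor odd b)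
      ≡⟨ xor-interchange (odd ⌊ x /2⌋) _ _ _ ⟩
    (odd ⌊ x /2⌋ xor odd ⌊ y /2⌋) xor (odd a xor odd b)
      ≡⟨ cong ((odd ⌊ x /2⌋ xor odd ⌊ y /2⌋) xor_) (sS 0 refl (1-or-3 y oy y<4)) ⟩
    (odd ⌊ x /2⌋ xor odd ⌊ y /2⌋) xor (odd a′ xor odd b′)
      ≡⟨ xor-interchange (odd ⌊ x /2⌋) _ _ _ ⟩
    (odd ⌊ x /2⌋ xor odd a′) xor (odd ⌊ y /2⌋ xor odd b′)
      ≡⟨ cong₂ _xor_ (odd-shift₀ ⌊ x /2⌋ a′) (odd-shift₀ ⌊ y /2⌋ b′) ⟨
    odd (⌊ x /2⌋ + 1 * a′) xor odd (⌊ y /2⌋ + 1 * b′) ∎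
    where
    1-or-3 : ∀ y → odd y ≡ true → y < 4 → y ≡ 1 ⊎ y ≡ 3
    1-or-3 1 _ _ = inj₁ refl
    1-or-3 3 _ _ = inj₂ refl
    1-or-3 (suc (suc (suc (suc _)))) _ (s≤s (s≤s (s≤s (s≤s ()))))
... | inj₂ ey = begin
    hE (hE^ m h) (x + 2 ^ suc m * a) (y + 2 ^ suc m * b)      ≡⟨ unfold h a b ⟩
    hE^ m h (⌊ x /2⌋ + 2 ^ m * a) (⌊ y /2⌋ + 2 ^ m * b)       ≡⟨ hE^-agree m ⌊ x /2⌋ ⌊ y /2⌋ (half-< x<)
        (double-< 0<y y≡) (half-< y<) sS′
        (λ e x<W → hA (up e) (half<⇒<2* x<W))
        (λ e W≤x → hB (up e) (≤half⇒2*≤ W≤x)) ⟩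
    hE^ m h′ (⌊ x /2⌋ + 2 ^ m * a′) (⌊ y /2⌋ + 2 ^ m * b′)    ≡⟨ unfold h′ a′ b′ ⟨
    hE (hE^ m h′) (x + 2 ^ suc m * a′) (y + 2 ^ suc m * b′)   ∎
  where
  open ≡-Reasoning
  unfold : ∀ h a b → hE (hE^ m h) (x + 2 ^ suc m * a) (y + 2 ^ suc m * b) ≡
                     hE^ m h (⌊ x /2⌋ + 2 ^ m * a) (⌊ y /2⌋ + 2 ^ m * b)
  unfold h a b = trans
    (hE-even (hE^ m h) (x + 2 ^ suc m * a) (y + 2 ^ suc m * b) (trans (odd-shift m y b) ey))
    (cong₂ (hE^ m h) (half-shift m x a) (half-shift m y b))
  y≡ : y ≡ 2 * ⌊ y /2⌋
  y≡ = even-split y ey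
  up : ∀ {g} → ⌊ y /2⌋ ≡ g → y ≡ 2 * g
  up e = trans y≡ (cong (2 *_) e)
  sS′ : ∀ l → m ≡ suc l → ⌊ y /2⌋ ≡ 2 ^ l ⊎ ⌊ y /2⌋ ≡ 2 ^ m + 2 ^ l → odd a xor odd b ≡ odd a′ xor odd b′
  sS′ l refl (inj₁ e) = sS (suc l) refl (inj₁ (up e))
  sS′ l refl (inj₂ e) = sS (suc l) refl (inj₂ (trans (up e) (*-distribˡ-+ 2 (2 ^ suc l) (2 ^ l))))

-- The row version, governed by the valuation of x + 1. The strict bound on `suc x` excludes the
-- last row of the second block, so `ρ m` is the only row that reaches the coarse plane.
vE^-agree : ∀ m {v v′ a b a′ b′} x y → suc x < 2 ^ suc m → y < 2 ^ suc m →
  (∀ l → m ≡ suc l → x ≡ ρ l ⊎ x ≡ 2 ^ m + ρ l → odd a ≡ odd a′) →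
  (x ≡ ρ m → y < 2 ^ m → v a b ≡ v′ a′ b′) →
  (x ≡ ρ m → 2 ^ m ≤ y → v a (suc b) ≡ v′ a′ (suc b′)) →
  vE^ m v (x + 2 ^ m * a) (y + 2 ^ m * b) ≡ vE^ m v′ (x + 2 ^ m * a′) (y + 2 ^ m * b′)
vE^-agree zero {v} {v′} {a} {b} {a′} {b′} zero y _ y< _ vA vB
  rewrite +-identityʳ a | +-identityʳ b | +-identityʳ a′ | +-identityʳ b′ with y
... | 0           = vA refl (s≤s z≤n)
... | 1           = vB refl (s≤s z≤n)
... | suc (suc _) = contradiction y< λ { (s≤s (s≤s ())) }
vE^-agree zero (suc x) y (s≤s (s≤s ()))
vE^-agree (suc m) {v} {v′} {a} {b} {a′} {b′} x y x< y< sP vA vB with true-or-false (odd x)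
... | inj₂ ex = begin
    vE (vE^ m v) (x + 2 ^ suc m * a) (y + 2 ^ suc m * b)     ≡⟨ unfold v a b ⟩
    odd (⌊ x /2⌋ + 2 ^ m * a) xor odd y                      ≡⟨ cong (_xor odd y) (indep m x< sP) ⟩
    odd (⌊ x /2⌋ + 2 ^ m * a′) xor odd y                     ≡⟨ unfold v′ a′ b′ ⟨
    vE (vE^ m v′) (x + 2 ^ suc m * a′) (y + 2 ^ suc m * b′)  ∎
  where
  open ≡-Reasoning
  unfold : ∀ v a b → vE (vE^ m v) (x + 2 ^ suc m * a) (y + 2 ^ suc m * b) ≡
                     odd (⌊ x /2⌋ + 2 ^ m * a) xor odd y
  unfold v a b = trans
    (vE-even (vE^ m v) (x + 2 ^ suc m * a) (y + 2 ^ suc m * b) (trans (odd-shift m x a) ex))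
    (cong₂ _xor_ (cong odd (half-shift m x a)) (odd-shift m y b))
  indep : ∀ m → suc x < 2 ^ suc (suc m) →
    (∀ l → suc m ≡ suc l → x ≡ ρ l ⊎ x ≡ 2 ^ suc m + ρ l → odd a ≡ odd a′) →
    odd (⌊ x /2⌋ + 2 ^ m * a) ≡ odd (⌊ x /2⌋ + 2 ^ m * a′)
  indep (suc m) _ _ = trans (odd-shift m ⌊ x /2⌋ a) (sym (odd-shift m ⌊ x /2⌋ a′))
  indep zero x<3 sP = begin
    odd (⌊ x /2⌋ + 1 * a)     ≡⟨ odd-shift₀ ⌊ x /2⌋ a ⟩
    odd ⌊ x /2⌋ xor odd a     ≡⟨ cong (odd ⌊ x /2⌋ xor_) (sP 0 refl (0-or-2 x ex x<3)) ⟩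
    odd ⌊ x /2⌋ xor odd a′    ≡⟨ odd-shift₀ ⌊ x /2⌋ a′ ⟨
    odd (⌊ x /2⌋ + 1 * a′)    ∎
    where
    0-or-2 : ∀ x → odd x ≡ false → suc x < 4 → x ≡ 0 ⊎ x ≡ 2
    0-or-2 0 _ _ = inj₁ refl
    0-or-2 2 _ _ = inj₂ refl
    0-or-2 (suc (suc (suc _))) _ (s≤s (s≤s (s≤s (s≤s ()))))
... | inj₁ ox = begin
    vE (vE^ m v) (x + 2 ^ suc m * a) (y + 2 ^ suc m * b)      ≡⟨ unfold v a b ⟩
    vE^ m v (⌊ x /2⌋ + 2 ^ m * a) (⌊ y /2⌋ + 2 ^ m * b)       ≡⟨ vE^-agree m ⌊ x /2⌋ ⌊ y /2⌋ x′<
        (half-< y<) sP′ (λ e y<W → vA (up e) (half<⇒<2* y<W)) (λ e W≤y → vB (up e) (≤half⇒2*≤ W≤y)) ⟩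
    vE^ m v′ (⌊ x /2⌋ + 2 ^ m * a′) (⌊ y /2⌋ + 2 ^ m * b′)    ≡⟨ unfold v′ a′ b′ ⟨
    vE (vE^ m v′) (x + 2 ^ suc m * a′) (y + 2 ^ suc m * b′)   ∎
  where
  open ≡-Reasoning
  unfold : ∀ v a b → vE (vE^ m v) (x + 2 ^ suc m * a) (y + 2 ^ suc m * b) ≡
                     vE^ m v (⌊ x /2⌋ + 2 ^ m * a) (⌊ y /2⌋ + 2 ^ m * b)
  unfold v a b = trans
    (vE-odd (vE^ m v) (x + 2 ^ suc m * a) (y + 2 ^ suc m * b) (trans (odd-shift m x a) ox))
    (cong₂ (vE^ m v) (half-shift m x a) (half-shift m y b))
  x≡ : x ≡ suc (2 * ⌊ x /2⌋)
  x≡ = odd-split x ox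
  x′< : suc ⌊ x /2⌋ < 2 ^ suc m
  x′< = subst (_< 2 ^ suc m) (half-suc-odd x ox) (half-< x<)
  up : ∀ {g} → ⌊ x /2⌋ ≡ g → x ≡ suc (2 * g)
  up e = trans x≡ (cong (λ g → suc (2 * g)) e)
  sP′ : ∀ l → m ≡ suc l → ⌊ x /2⌋ ≡ ρ l ⊎ ⌊ x /2⌋ ≡ 2 ^ m + ρ l → odd a ≡ odd a′
  sP′ l refl (inj₁ e) = sP (suc l) refl (inj₁ (up e))
  sP′ l refl (inj₂ e) = sP (suc l) refl (inj₂ (trans (up e) (lemma (2 ^ suc l) (ρ l))))
    where
    lemma : ∀ q r → suc (2 * (q + r)) ≡ 2 * q + suc (2 * r)
    lemma = solve-∀

-- Codes at a grid corner and their visible parts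

Code : Set
Code = Vec Bool 6

-- The parities of a and a + b, and the four creases meeting at the corner of the cells (a , b) and (a + 1 , b + 1).
pattern code p s hA hB vA vB = p Vec.∷ s Vec.∷ hA Vec.∷ hB Vec.∷ vA Vec.∷ vB Vec.∷ Vec.[]

code-cong : ∀ {p p′ s s′ hA hA′ hB hB′ vA vA′ vB vB′} → p ≡ p′ → s ≡ s′ → hA ≡ hA′ → hB ≡ hB′ → vA ≡ vA′ → vB ≡ vB′ →
  _≡_ {A = Code} (code p s hA hB vA vB) (code p′ s′ hA′ hB′ vA′ vB′)
code-cong refl refl refl refl refl refl = refl

codeAt : Site → Code
codeAt (site h v a b) =
  code (odd a) (odd a xor odd b) (h a (suc b)) (h (suc a) (suc b)) (v a b) (v a (suc b))

-- Starting at `suc q` with q < 2^m keeps the window off column 0 of its block, so the first grid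
-- column it can meet is 2^m. Rows need no such shift, since a grid row is the last row of its
-- block.
zoom : ℕ → ℕ → ℕ → Site → Site
zoom m u q (site h v a b) = site (hE^ m h) (vE^ m v) (u + 2 ^ m * a) (suc q + 2 ^ m * b)

bit : Bool → ℕ
bit false = 0
bit true  = 1

-- Artificial planes with a prescribed code; in general they are no paperfolding planes. Since s is
-- the parity of a + b, the column b can be taken as p xor s. The comparisons separate index a from
-- a + 1 and b from b + 1.
siteOf : Code → Site
siteOf (code p s hA hB vA vB) =
  site (λ i _ → if i ≤ᵇ bit p then hA else hB) (λ _ j → if j ≤ᵇ bit (p xor s) then vA else vB) (bit p) (bit (p xor s))

codeAt-siteOf : ∀ c → codeAt (siteOf c) ≡ c
codeAt-siteOf (code true  true  _ _ _ _) = refl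
codeAt-siteOf (code true  false _ _ _ _) = refl
codeAt-siteOf (code false true  _ _ _ _) = refl
codeAt-siteOf (code false false _ _ _ _) = refl

Flags : Set
Flags = Bool × Bool × Bool

-- Row flags: a row showing p, the grid row, a row below it. Column flags: a column showing s, the
-- grid column, a column left of it. `hA` needs no row flag because the first row of the window
-- always lies above the grid line. Hidden bits become false, so equal masked codes mean equal
-- visible bits.
mask : Flags → Flags → Code → Code
mask (fP , fR , fB) (fS , fC , fN) (code p s hA hB vA vB) =
  code (fP ∧ p) (fS ∧ s) (fC ∧ hA) ((fC ∧ fB) ∧ hB) ((fR ∧ fN) ∧ vA) ((fR ∧ fC) ∧ vB)

∧-guard : ∀ f {b b′} → (f ≡ true → b ≡ b′) → f ∧ b ≡ f ∧ b′
∧-guard true  eq = eq refl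
∧-guard false eq = refl

∧-unguard : ∀ f {b b′} → f ∧ b ≡ f ∧ b′ → f ≡ true → b ≡ b′
∧-unguard .true eq refl = eq

∧-true : ∀ {a b} → a ≡ true → b ≡ true → a ∧ b ≡ true
∧-true refl refl = refl

∧-true⁻ : ∀ {a b} → a ∧ b ≡ true → a ≡ true × b ≡ true
∧-true⁻ {true} {true} refl = refl , refl

∨-true⁻ : ∀ {a b} → a ∨ b ≡ true → a ≡ true ⊎ b ≡ true
∨-true⁻ {true}  _ = inj₁ refl
∨-true⁻ {false} e = inj₂ e

does-true⁻ : ∀ {ℓ} {X : Set ℓ} (d : Dec X) → does d ≡ true → X
does-true⁻ (yes x) _ = x

reach : ∀ {u g n} → u ≤ g → g < u + n → ∃ λ r → r < n × r + u ≡ g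
reach {u} {g} {n} u≤g g< = g ∸ u , +-cancelʳ-≤ u (suc (g ∸ u)) n bound , m∸n+n≡m u≤g
  where
  bound : suc (g ∸ u) + u ≤ n + u
  bound = subst₂ _≤_ (cong suc (sym (m∸n+n≡m u≤g))) (+-comm u n) g<

-- Which bits of the code at a corner are visible in an n × n window with corner in row u (in column suc q)
-- of an aligned block of size w = 2 m.
rowFlagsOf colFlagsOf : ℕ → ℕ → ℕ → ℕ → Flags
rowFlagsOf w m n u = does (u <? m) ∨ does (w + m ≤? u + n) , does (w ≤? u + n) , does (w <? u + n)
colFlagsOf w m n q = does (q <? m) ∨ does (w + m ≤? q + n) , does (w ≤? q + n) , does (suc q <? w)

module Window (l n : ℕ) where

  wid hlf : ℕ
  wid = 2 ^ suc l
  hlf = 2 ^ l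

  rowFlags colFlags : ℕ → Flags
  rowFlags = rowFlagsOf wid hlf n
  colFlags = colFlagsOf wid hlf n

  view : ℕ → ℕ → Code → Code
  view u q = mask (rowFlags u) (colFlags q)

  module _ (n≤wid : n ≤ wid) {u q : ℕ} (u< : u < wid) (q< : q < wid) where

    private
      2wid : ∀ {i j} → i ≤ wid → j ≤ wid → i + j ≤ 2 ^ suc (suc l)
      2wid i≤ j≤ = ≤-trans (+-mono-≤ i≤ j≤) (≤-reflexive (cong (wid +_) (sym (+-identityʳ wid))))

    view⇒Same : ∀ p p′ → view u q (codeAt p) ≡ view u q (codeAt p′) →
      Same n (zoom (suc l) u q p) (zoom (suc l) u q p′)
    view⇒Same (site h v a b) (site h′ v′ a′ b′) eq r c r<n c<n
      rewrite sym (+-assoc r u (wid * a)) | sym (+-assoc r u (wid * a′))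
            | sym (+-assoc c (suc q) (wid * b)) | sym (+-assoc c (suc q) (wid * b′)) =
      hE^-agree (suc l) (r + u) (c + suc q) (2wid {suc r} {u} r≤ (<⇒≤ u<)) (≤-trans (s≤s z≤n) (m≤n+m (suc q) c))
        (2wid {suc c} {suc q} c≤ q<) sS hA hB ,
      vE^-agree (suc l) (r + u) (c + suc q) (subst (_≤ 2 ^ suc (suc l)) (cong suc (+-suc r u)) (2wid {suc r} {suc u} r≤ u<))
        (2wid {suc c} {suc q} c≤ q<) sP vA vB
      where
      r≤ : suc r ≤ wid
      r≤ = ≤-trans r<n n≤wid
      c≤ : suc c ≤ wid
      c≤ = ≤-trans c<n n≤wid
      row-bound : ∀ {g} → suc (r + u) ≡ g → g ≤ u + n
      row-bound refl = ≤-trans (+-monoˡ-≤ u r<n) (≤-reflexive (+-comm n u))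
      col-bound : ∀ {g} → c + suc q ≡ g → g ≤ q + n
      col-bound refl = ≤-trans (≤-reflexive (+-suc c q)) (≤-trans (+-monoˡ-≤ q c<n) (≤-reflexive (+-comm n q)))
      col-bound-≤ : ∀ {g} → g ≤ c + suc q → g ≤ q + n
      col-bound-≤ g≤ = ≤-trans g≤ (col-bound refl)
      fC : wid ≤ q + n → does (wid ≤? q + n) ≡ true
      fC = dec-true (wid ≤? q + n)
      fR : r + u ≡ ρ (suc l) → does (wid ≤? u + n) ≡ true
      fR e = dec-true (wid ≤? u + n) (row-bound (trans (cong suc e) (suc-ρ (suc l))))
      sS : ∀ l′ → suc l ≡ suc l′ → c + suc q ≡ 2 ^ l′ ⊎ c + suc q ≡ wid + 2 ^ l′ → odd a xor odd b ≡ odd a′ xor odd b′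
      sS .l refl e = ∧-unguard _ (cong (λ { (code _ s _ _ _ _) → s }) eq) (flag e)
        where
        flag : c + suc q ≡ hlf ⊎ c + suc q ≡ wid + hlf → proj₁ (colFlags q) ≡ true
        flag (inj₁ e) = cong (_∨ does (wid + hlf ≤? q + n)) (dec-true (q <? hlf) (subst (suc q ≤_) e (m≤n+m (suc q) c)))
        flag (inj₂ e) = trans (cong (does (q <? hlf) ∨_) (dec-true (wid + hlf ≤? q + n) (col-bound e))) (∨-zeroʳ _)
      sP : ∀ l′ → suc l ≡ suc l′ → r + u ≡ ρ l′ ⊎ r + u ≡ wid + ρ l′ → odd a ≡ odd a′
      sP .l refl e = ∧-unguard _ (cong (λ { (code p _ _ _ _ _) → p }) eq) (flag e)
        where
        flag : r + u ≡ ρ l ⊎ r + u ≡ wid + ρ l → proj₁ (rowFlags u) ≡ true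
        flag (inj₁ e) = cong (_∨ does (wid + hlf ≤? u + n)) (dec-true (u <? hlf) (≤-<-trans (subst (u ≤_) e (m≤n+m u r)) (ρ< l)))
        flag (inj₂ e) = trans (cong (does (u <? hlf) ∨_) (dec-true (wid + hlf ≤? u + n)
                          (row-bound (trans (cong suc e) (trans (sym (+-suc wid (ρ l))) (cong (wid +_) (suc-ρ l))))))) (∨-zeroʳ _)
      hA : c + suc q ≡ wid → r + u < wid → h a (suc b) ≡ h′ a′ (suc b′)
      hA e _ = ∧-unguard _ (cong (λ { (code _ _ hA _ _ _) → hA }) eq) (fC (col-bound e))
      hB : c + suc q ≡ wid → wid ≤ r + u → h (suc a) (suc b) ≡ h′ (suc a′) (suc b′)
      hB e le = ∧-unguard _ (cong (λ { (code _ _ _ hB _ _) → hB }) eq)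
        (∧-true (fC (col-bound e)) (dec-true (wid <? u + n) (≤-trans (s≤s le) (row-bound refl))))
      vA : r + u ≡ ρ (suc l) → c + suc q < wid → v a b ≡ v′ a′ b′
      vA e lt = ∧-unguard _ (cong (λ { (code _ _ _ _ vA _) → vA }) eq)
        (∧-true (fR e) (dec-true (suc q <? wid) (≤-<-trans (m≤n+m (suc q) c) lt)))
      vB : r + u ≡ ρ (suc l) → wid ≤ c + suc q → v a (suc b) ≡ v′ a′ (suc b′)
      vB e le = ∧-unguard _ (cong (λ { (code _ _ _ _ _ vB) → vB }) eq)
        (∧-true (fR e) (fC (col-bound-≤ le)))

    -- Each flag certifies that a cell carrying its bit lies in the window. The bound `hlf ≤ n`
    -- ensures that a window starting before the parity row or column of the first block also
    -- reaches it.
    Same⇒view : hlf ≤ n → 0 < n → ∀ p p′ → Same n (zoom (suc l) u q p) (zoom (suc l) u q p′) →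
      view u q (codeAt p) ≡ view u q (codeAt p′)
    Same⇒view hlf≤n 0<n p@(site h v a b) p′@(site h′ v′ a′ b′) same =
      code-cong
        (∧-guard (proj₁ (rowFlags u)) eP)
        (∧-guard (proj₁ (colFlags q)) eS)
        (∧-guard _ λ f → eA (does-true⁻ (wid ≤? q + n) f))
        (∧-guard _ λ f → eB (does-true⁻ (wid ≤? q + n) (proj₁ (∧-true⁻ f))) (does-true⁻ (wid <? u + n) (proj₂ (∧-true⁻ f))))
        (∧-guard _ λ f → eV (does-true⁻ (wid ≤? u + n) (proj₁ (∧-true⁻ f))) (does-true⁻ (suc q <? wid) (proj₂ (∧-true⁻ f))))
        (∧-guard _ λ f → eW (does-true⁻ (wid ≤? u + n) (proj₁ (∧-true⁻ f))) (does-true⁻ (wid ≤? q + n) (proj₂ (∧-true⁻ f))))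
      where
      open ≡-Reasoning
      hor-at : ∀ {r c x y} → r < n → c < n → r + u ≡ x → c + suc q ≡ y →
        hE^ (suc l) h (x + wid * a) (y + wid * b) ≡ hE^ (suc l) h′ (x + wid * a′) (y + wid * b′)
      hor-at {r} {c} r< c< refl refl =
        trans (cong₂ (hE^ (suc l) h) (+-assoc r u _) (+-assoc c (suc q) _))
        (trans (proj₁ (same r c r< c<))
        (sym (cong₂ (hE^ (suc l) h′) (+-assoc r u _) (+-assoc c (suc q) _))))
      ver-at : ∀ {r c x y} → r < n → c < n → r + u ≡ x → c + suc q ≡ y →
        vE^ (suc l) v (x + wid * a) (y + wid * b) ≡ vE^ (suc l) v′ (x + wid * a′) (y + wid * b′)
      ver-at {r} {c} r< c< refl refl =
        trans (cong₂ (vE^ (suc l) v) (+-assoc r u _) (+-assoc c (suc q) _))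
        (trans (proj₂ (same r c r< c<))
        (sym (cong₂ (vE^ (suc l) v′) (+-assoc r u _) (+-assoc c (suc q) _))))
      carry : ∀ g w t → w + g + w * t ≡ g + w * suc t
      carry = solve-∀
      carry₀ : ∀ w t → w + w * t ≡ w * suc t
      carry₀ = solve-∀
      corner-row : wid ≤ u + n → ∃ λ r → r < n × r + u ≡ ρ (suc l)
      corner-row le = reach (s≤s⁻¹ (≤-trans u< (≤-reflexive (sym (suc-ρ (suc l)))))) (subst (_≤ u + n) (sym (suc-ρ (suc l))) le)
      corner-col : wid ≤ q + n → ∃ λ c → c < n × c + suc q ≡ wid
      corner-col le = reach q< (s≤s le)

      eP : proj₁ (rowFlags u) ≡ true → odd a ≡ odd a′
      eP f with ∨-true⁻ {does (u <? hlf)} f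
      ... | inj₁ f with reach {u} {ρ l} {n} (s≤s⁻¹ (≤-trans (does-true⁻ (u <? hlf) f) (≤-reflexive (sym (suc-ρ l)))))
                              (≤-trans (≤-reflexive (suc-ρ l)) (≤-trans hlf≤n (m≤n+m n u)))
      ...   | r , r< , e = xor-cancelʳ (vbit l (suc q)) (begin
              odd a xor vbit l (suc q)                               ≡⟨ vE^-read {l} v a (suc q) b ≤-refl ⟨
              vE^ (suc l) v (ρ l + wid * a) (suc q + wid * b)        ≡⟨ ver-at {r} {0} r< 0<n e refl ⟩
              vE^ (suc l) v′ (ρ l + wid * a′) (suc q + wid * b′)     ≡⟨ vE^-read {l} v′ a′ (suc q) b′ ≤-refl ⟩
              odd a′ xor vbit l (suc q)                              ∎)
      eP _ | inj₂ f with reach {u} {wid + ρ l} {n} (≤-trans (<⇒≤ u<) (m≤m+n wid _))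
                              (≤-trans (≤-reflexive (trans (sym (+-suc wid (ρ l))) (cong (wid +_) (suc-ρ l)))) (does-true⁻ (wid + hlf ≤? u + n) f))
      -- The visible parity row lies in the next block and shows the parity of a + 1, so a negation
      -- is cancelled as well.
      ...   | r , r< , e = xor-cancelˡ true (xor-cancelʳ (vbit l (suc q)) (begin
              odd (suc a) xor vbit l (suc q)                             ≡⟨ read v a b ⟨
              vE^ (suc l) v (wid + ρ l + wid * a) (suc q + wid * b)      ≡⟨ ver-at {r} {0} r< 0<n e refl ⟩
              vE^ (suc l) v′ (wid + ρ l + wid * a′) (suc q + wid * b′)   ≡⟨ read v′ a′ b′ ⟩
              odd (suc a′) xor vbit l (suc q)                            ∎))
        where
        read : ∀ v a b → vE^ (suc l) v (wid + ρ l + wid * a) (suc q + wid * b) ≡ odd (suc a) xor vbit l (suc q)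
        read v a b = trans (cong (λ i → vE^ (suc l) v i (suc q + wid * b)) (carry (ρ l) wid a)) (vE^-read {l} v (suc a) (suc q) b ≤-refl)

      eS : proj₁ (colFlags q) ≡ true → odd a xor odd b ≡ odd a′ xor odd b′
      eS f with ∨-true⁻ {does (q <? hlf)} f
      ... | inj₁ f with reach {suc q} {hlf} {n} (does-true⁻ (q <? hlf) f) (s≤s (≤-trans hlf≤n (m≤n+m n q)))
      ...   | c , c< , e = xor-cancelʳ (hbit l u) (begin
              (odd a xor odd b) xor hbit l u                        ≡⟨ hE^-read {l} h u a b ≤-refl ⟨
              hE^ (suc l) h (u + wid * a) (hlf + wid * b)           ≡⟨ hor-at {0} {c} 0<n c< refl e ⟩
              hE^ (suc l) h′ (u + wid * a′) (hlf + wid * b′)        ≡⟨ hE^-read {l} h′ u a′ b′ ≤-refl ⟩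
              (odd a′ xor odd b′) xor hbit l u                      ∎)
      eS _ | inj₂ f with reach {suc q} {wid + hlf} {n} (≤-trans q< (m≤m+n wid hlf)) (s≤s (does-true⁻ (wid + hlf ≤? q + n) f))
      ...   | c , c< , e = xor-cancelˡ true (xor-cancelʳ (hbit l u) (begin
              not (odd a xor odd b) xor hbit l u                        ≡⟨ read h a b ⟨
              hE^ (suc l) h (u + wid * a) (wid + hlf + wid * b)         ≡⟨ hor-at {0} {c} 0<n c< refl e ⟩
              hE^ (suc l) h′ (u + wid * a′) (wid + hlf + wid * b′)      ≡⟨ read h′ a′ b′ ⟩
              not (odd a′ xor odd b′) xor hbit l u                      ∎))
        where
        read : ∀ h a b → hE^ (suc l) h (u + wid * a) (wid + hlf + wid * b) ≡ not (odd a xor odd b) xor hbit l u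
        read h a b = trans (cong (hE^ (suc l) h (u + wid * a)) (carry hlf wid b))
          (trans (hE^-read {l} h u a (suc b) ≤-refl) (cong (_xor hbit l u) (xor-not (odd a) (odd b))))

      eA : wid ≤ q + n → h a (suc b) ≡ h′ a′ (suc b′)
      eA le with corner-col le
      ... | c , c< , e = trans (sym (read h a b)) (trans (hor-at {0} {c} 0<n c< refl e) (read h′ a′ b′))
        where
        read : ∀ h a b → hE^ (suc l) h (u + wid * a) (wid + wid * b) ≡ h a (suc b)
        read h a b = trans (cong (hE^ (suc l) h (u + wid * a)) (carry₀ wid b)) (hE^-block (suc l) h u a (suc b) u<)

      eB : wid ≤ q + n → wid < u + n → h (suc a) (suc b) ≡ h′ (suc a′) (suc b′)
      eB le lt with corner-col le | reach (<⇒≤ u<) lt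
      ... | c , c< , e | r , r< , e′ = trans (sym (read h a b)) (trans (hor-at {r} {c} r< c< e′ e) (read h′ a′ b′))
        where
        read : ∀ h a b → hE^ (suc l) h (wid + wid * a) (wid + wid * b) ≡ h (suc a) (suc b)
        read h a b = trans (cong₂ (hE^ (suc l) h) (carry₀ wid a) (carry₀ wid b)) (hE^-block (suc l) h 0 (suc a) (suc b) (m^n>0 2 (suc l)))

      eV : wid ≤ u + n → suc q < wid → v a b ≡ v′ a′ b′
      eV le lt with corner-row le
      ... | r , r< , e = trans (sym (vE^-block (suc l) v a (suc q) b lt))
                         (trans (ver-at {r} {0} r< 0<n e refl) (vE^-block (suc l) v′ a′ (suc q) b′ lt))

      eW : wid ≤ u + n → wid ≤ q + n → v a (suc b) ≡ v′ a′ (suc b′)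
      eW le le′ with corner-row le | corner-col le′
      ... | r , r< , e | c , c< , e′ = trans (sym (read v a b)) (trans (ver-at {r} {c} r< c< e e′) (read v′ a′ b′))
        where
        read : ∀ v a b → vE^ (suc l) v (ρ (suc l) + wid * a) (wid + wid * b) ≡ v a (suc b)
        read v a b = trans (cong (vE^ (suc l) v (ρ (suc l) + wid * a)) (carry₀ wid b)) (vE^-block (suc l) v a 0 (suc b) (m^n>0 2 (suc l)))

Cong-zoom : ∀ k {u u′ a a′} → Cong k (u + 2 ^ k * a) (u′ + 2 ^ k * a′) → u < 2 ^ k → u′ < 2 ^ k → u ≡ u′
Cong-zoom k {u} {u′} {a} {a′} (c , t , t′ , eq , eq′) u< u′< = begin
  u            ≡⟨ remainder u a c t u< eq ⟩
  c % 2 ^ k    ≡⟨ remainder u′ a′ c t′ u′< eq′ ⟨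
  u′           ∎
  where
  open ≡-Reasoning
  instance _ = m^n≢0 2 k
  remainder : ∀ u a c t → u < 2 ^ k → u + 2 ^ k * a ≡ c + 2 ^ k * t → u ≡ c % 2 ^ k
  remainder u a c t u< eq = begin
    u                          ≡⟨ m<n⇒m%n≡m u< ⟨
    u % 2 ^ k                  ≡⟨ [m+kn]%n≡m%n u a (2 ^ k) ⟨
    (u + a * 2 ^ k) % 2 ^ k    ≡⟨ cong (λ x → (u + x) % 2 ^ k) (*-comm a (2 ^ k)) ⟩
    (u + 2 ^ k * a) % 2 ^ k    ≡⟨ cong (_% 2 ^ k) eq ⟩
    (c + 2 ^ k * t) % 2 ^ k    ≡⟨ cong (λ x → (c + x) % 2 ^ k) (*-comm (2 ^ k) t) ⟩
    (c + t * 2 ^ k) % 2 ^ k    ≡⟨ [m+kn]%n≡m%n c t (2 ^ k) ⟩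
    c % 2 ^ k                  ∎

same-position : ∀ {l n u q u′ q′} p p′ → 3 ≤ n → 2 ^ suc l ≤ n →
  u < 2 ^ (2 + l) → q < 2 ^ (2 + l) → u′ < 2 ^ (2 + l) → q′ < 2 ^ (2 + l) →
  Same n (zoom (2 + l) u q p) (zoom (2 + l) u′ q′ p′) → u ≡ u′ × q ≡ q′
same-position {l} {n} {u} {q} {u′} {q′} (site h v a b) (site h′ v′ a′ b′) 3≤n L≤n u< q< u′< q′< same
  with position-mod h h′ v v′ 3≤n same (suc l) ≤-refl L≤n
... | ci , (c , t , t′ , eq , eq′) =
  Cong-zoom (2 + l) ci u< u′< ,
  -- Adding `ρ (2 + l)`, which is -1 modulo the block size, turns a congruence for `suc q` into one
  -- for q.
  Cong-zoom (2 + l) (ρ (2 + l) + c , t , t′ , shift q b t eq , shift q′ b′ t′ eq′) q< q′<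
  where
  open ≡-Reasoning
  shift : ∀ q b t → suc q + 2 ^ (2 + l) * b ≡ c + 2 ^ (2 + l) * t →
    q + 2 ^ (2 + l) * suc b ≡ ρ (2 + l) + c + 2 ^ (2 + l) * t
  shift q b t eq = begin
    q + 2 ^ (2 + l) * suc b                    ≡⟨ cong (q +_) (*-suc (2 ^ (2 + l)) b) ⟩
    q + (2 ^ (2 + l) + 2 ^ (2 + l) * b)        ≡⟨ cong (λ w → q + (w + 2 ^ (2 + l) * b)) (suc-ρ (2 + l)) ⟨
    q + (suc (ρ (2 + l)) + 2 ^ (2 + l) * b)    ≡⟨ lemma q (ρ (2 + l)) (2 ^ (2 + l) * b) ⟩
    ρ (2 + l) + (suc q + 2 ^ (2 + l) * b)      ≡⟨ cong (ρ (2 + l) +_) eq ⟩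
    ρ (2 + l) + (c + 2 ^ (2 + l) * t)          ≡⟨ +-assoc (ρ (2 + l)) c _ ⟨
    ρ (2 + l) + c + 2 ^ (2 + l) * t            ∎
    where
    lemma : ∀ q r x → q + (suc r + x) ≡ r + (suc q + x)
    lemma = solve-∀

-- Vertex conditions

-- This leaves 8 codes with p false, 4 with p and s true, and 8 with p true and s false: 20 in all.
valid : Code → Bool
valid (code p s hA hB vA vB) =
  ((hA xor hB) xor (vA xor vB)) ∧ (if p then not s ∨ (hA xor hB) else not (hA xor hB))

-- At a flat-folded vertex of degree four, mountains and valleys differ in number by two, so the
-- number of mountains is odd.
Maekawa : Plane → Plane → Set
Maekawa h v = ∀ a b → (h a (suc b) xor h (suc a) (suc b)) xor (v a b xor v a (suc b)) ≡ true

xor-notʳ : ∀ b → b xor not b ≡ true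
xor-notʳ true  = refl
xor-notʳ false = refl

valid-even : ∀ {p hB vB} s hA vA → p ≡ false → hB ≡ hA → vB ≡ not vA → valid (code p s hA hB vA vB) ≡ true
valid-even s hA vA refl refl refl rewrite xor-same hA | xor-notʳ vA = refl

valid-flip : ∀ {p hB vB} s hA vA → p ≡ true → hB ≡ not hA → vB ≡ vA → valid (code p s hA hB vA vB) ≡ true
valid-flip s hA vA refl refl refl rewrite xor-notʳ hA | xor-same vA = ∨-zeroʳ (not s)

valid-vertex : ∀ {p s} hA hB vA vB → p ≡ true → s ≡ false → (hA xor hB) xor (vA xor vB) ≡ true →
  valid (code p s hA hB vA vB) ≡ true
valid-vertex hA hB vA vB refl refl eq = ∧-true eq refl

-- For a even, h repeats across the row pair and v alternates; for a odd and b even, h flips and v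
-- repeats. For both odd, all four creases are inherited from the vertex at the halved indices, and
-- only Maekawa's condition survives.
valid-at : ∀ h v → Maekawa h v → ∀ a b → valid (codeAt (site (hE h) (vE v) a b)) ≡ true
valid-at h v mk a b with true-or-false (odd a) | true-or-false (odd b)
... | inj₂ ea | _ =
  valid-even (odd a xor odd b) (hE h a (suc b)) (vE v a b) ea (hE-row-pair h a (suc b) ea) (vE-flip v a b ea)
... | inj₁ oa | inj₂ eb =
  valid-flip (odd a xor odd b) (hE h a (suc b)) (vE v a b) oa (hE-flip h a (suc b) oa (cong not eb)) (vE-col-pair v a b oa eb)
... | inj₁ oa | inj₁ ob =
  valid-vertex (hE h a (suc b)) (hE h (suc a) (suc b)) (vE v a b) (vE v a (suc b)) oa (cong₂ _xor_ oa ob) vertex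
  where
  vertex : (hE h a (suc b) xor hE h (suc a) (suc b)) xor (vE v a b xor vE v a (suc b)) ≡ true
  vertex = trans (cong₂ _xor_
      (cong₂ _xor_ (trans (hE-even h a (suc b) (cong not ob)) (cong (h ⌊ a /2⌋) (half-suc-odd b ob)))
                   (trans (hE-even h (suc a) (suc b) (cong not ob)) (cong₂ h (half-suc-odd a oa) (half-suc-odd b ob))))
      (cong₂ _xor_ (vE-odd v a b oa) (trans (vE-odd v a (suc b) oa) (cong (v ⌊ a /2⌋) (half-suc-odd b ob)))))
    (mk ⌊ a /2⌋ ⌊ b /2⌋)

Maekawa-grow : ∀ h v → Maekawa h v → Maekawa (hE h) (vE v)
Maekawa-grow h v mk a b = proj₁ (∧-true⁻ (valid-at h v mk a b))

-- A seed satisfying Maekawa's condition. The creases of `T` do not see it: one step of the rule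
-- already fixes both bits at the even row 0 and the odd column 3, the cell they grow from.
h₀ v₀ : Plane
h₀ _ _ = true
v₀ _ j = odd j

Maekawa-level : ∀ k → Maekawa (hE^ k h₀) (vE^ k v₀)
Maekawa-level zero    a b = xor-notʳ (odd b)
Maekawa-level (suc k) = Maekawa-grow (hE^ k h₀) (vE^ k v₀) (Maekawa-level k)

bitStrings : ∀ n → List (Vec Bool n)
bitStrings zero    = Vec.[] ∷ []
bitStrings (suc n) = cartesianProductWith Vec._∷_ (false ∷ true ∷ []) (bitStrings n)

∈-bitStrings : ∀ {n} (c : Vec Bool n) → c ∈ bitStrings n
∈-bitStrings Vec.[]           = here refl
∈-bitStrings (false Vec.∷ c)  = ∈-cartesianProductWith⁺ Vec._∷_ {false ∷ true ∷ []} (here refl) (∈-bitStrings c)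
∈-bitStrings (true  Vec.∷ c)  = ∈-cartesianProductWith⁺ Vec._∷_ {false ∷ true ∷ []} (there (here refl)) (∈-bitStrings c)

validCodes : List Code
validCodes = filter (λ c → valid c Boolₚ.≟ true) (bitStrings 6)

valid⇒∈ : ∀ c → valid c ≡ true → c ∈ validCodes
valid⇒∈ c = ∈-filter⁺ (λ c → valid c Boolₚ.≟ true) (∈-bitStrings c)

-- Positions in T 4 (relative to its corner) at which the twenty valid codes occur.
places : List (Fin 15 × Fin 15)
places =
  (# 0 , # 0) ∷ (# 2 , # 2) ∷ (# 0 , # 2) ∷ (# 2 , # 0) ∷ (# 2 , # 1) ∷ (# 0 , # 1) ∷ (# 2 , # 5) ∷
  (# 0 , # 5) ∷ (# 1 , # 1) ∷ (# 1 , # 3) ∷ (# 3 , # 1) ∷ (# 7 , # 13) ∷ (# 7 , # 1) ∷ (# 3 , # 5) ∷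
  (# 1 , # 5) ∷ (# 1 , # 7) ∷ (# 1 , # 0) ∷ (# 3 , # 6) ∷ (# 3 , # 0) ∷ (# 1 , # 2) ∷ []

place-site : Fin 15 × Fin 15 → Site
place-site (a , b) = site (hE^ 5 h₀) (vE^ 5 v₀) (toℕ a) (toℕ b + 48)

-- Checked by evaluation; `places` follows the order in which `bitStrings` enumerates the codes. The
-- offset 48 in `place-site` is 3 * 2 ^ 4, the first column of `T 4`.
validCodes-placed : validCodes ≡ map (λ ab → codeAt (place-site ab)) places
validCodes-placed = refl

-- The crease planes of ST

-- The alphabet numbered in binary. The digits are the horizontal crease, the parity of i + j, the
-- parity of i, and the vertical crease.
letterOf : Bool → Bool → Bool → Bool → Letter
letterOf false false false false = A
letterOf false false false true  = B
letterOf false false true  false = C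
letterOf false false true  true  = D
letterOf false true  false false = E
letterOf false true  false true  = F
letterOf false true  true  false = G
letterOf false true  true  true  = H
letterOf true  false false false = I
letterOf true  false false true  = J
letterOf true  false true  false = K
letterOf true  false true  true  = L
letterOf true  true  false false = M
letterOf true  true  false true  = N
letterOf true  true  true  false = O
letterOf true  true  true  true  = P

symOf : Bool → Bool → Sym
symOf false false = s0
symOf false true  = s1
symOf true  false = s2
symOf true  true  = s3

bitsOf : Sym → Bool × Bool
bitsOf s0 = false , false
bitsOf s1 = false , true
bitsOf s2 = true  , false
bitsOf s3 = true  , true

bitsOf-symOf : ∀ a b → bitsOf (symOf a b) ≡ (a , b)
bitsOf-symOf false false = refl
bitsOf-symOf false true  = refl
bitsOf-symOf true  false = refl
bitsOf-symOf true  true  = refl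

symOf-injective : ∀ {a b a′ b′} → symOf a b ≡ symOf a′ b′ → a ≡ a′ × b ≡ b′
symOf-injective {a} {b} {a′} {b′} eq = cong proj₁ bits , cong proj₂ bits
  where
  bits : (a , b) ≡ (a′ , b′)
  bits = trans (sym (bitsOf-symOf a b)) (trans (cong bitsOf eq) (bitsOf-symOf a′ b′))

pick : ∀ {X : Set} → Bool → Bool → Block X → X
pick a b k = if a then (if b then z k else y k) else (if b then x k else w k)

μ-letterOf : ∀ d₃ d₂ d₁ d₀ → μ (letterOf d₃ d₂ d₁ d₀) ≡
  blk (letterOf d₃ false false d₁) (letterOf d₂ true false (not d₁)) (letterOf d₃ true true d₀) (letterOf d₂ false true d₀)
μ-letterOf false false false false = refl
μ-letterOf false false false true  = refl
μ-letterOf false false true  false = refl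
μ-letterOf false false true  true  = refl
μ-letterOf false true  false false = refl
μ-letterOf false true  false true  = refl
μ-letterOf false true  true  false = refl
μ-letterOf false true  true  true  = refl
μ-letterOf true  false false false = refl
μ-letterOf true  false false true  = refl
μ-letterOf true  false true  false = refl
μ-letterOf true  false true  true  = refl
μ-letterOf true  true  false false = refl
μ-letterOf true  true  false true  = refl
μ-letterOf true  true  true  false = refl
μ-letterOf true  true  true  true  = refl

φ-letterOf : ∀ d₃ d₂ d₁ d₀ → φ (letterOf d₃ d₂ d₁ d₀) ≡
  blk (symOf d₃ d₁) (symOf d₂ (not d₁)) (symOf d₃ d₀) (symOf d₂ d₀)
φ-letterOf false false false false = refl
φ-letterOf false false false true  = refl
φ-letterOf false false true  false = refl
φ-letterOf false false true  true  = refl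
φ-letterOf false true  false false = refl
φ-letterOf false true  false true  = refl
φ-letterOf false true  true  false = refl
φ-letterOf false true  true  true  = refl
φ-letterOf true  false false false = refl
φ-letterOf true  false false true  = refl
φ-letterOf true  false true  false = refl
φ-letterOf true  false true  true  = refl
φ-letterOf true  true  false false = refl
φ-letterOf true  true  false true  = refl
φ-letterOf true  true  true  false = refl
φ-letterOf true  true  true  true  = refl

-- In these digits the substitution is the folding rule: the first and last digits evolve by `hE`
-- and `vE`, the middle ones are the new parities.
pick-μ : ∀ a b d₃ d₂ d₁ d₀ → pick a b (μ (letterOf d₃ d₂ d₁ d₀)) ≡
  letterOf (if b then d₂ else d₃) (a xor b) a (if a then d₀ else d₁ xor b)
pick-μ a b d₃ d₂ d₁ d₀ rewrite μ-letterOf d₃ d₂ d₁ d₀ | xor-comm d₁ b with a | b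
... | false | false = refl
... | false | true  = refl
... | true  | false = refl
... | true  | true  = refl

pick-φ : ∀ a b d₃ d₂ d₁ d₀ → pick a b (φ (letterOf d₃ d₂ d₁ d₀)) ≡
  symOf (if b then d₂ else d₃) (if a then d₀ else d₁ xor b)
pick-φ a b d₃ d₂ d₁ d₀ rewrite φ-letterOf d₃ d₂ d₁ d₀ | xor-comm d₁ b with a | b
... | false | false = refl
... | false | true  = refl
... | true  | false = refl
... | true  | true  = refl

at-concat : ∀ {X Y : Set} {n} (g h : X → Y) (xs : Vec X n) j →
  at (concat (Vec.map (λ a → g a Vec.∷ h a Vec.∷ Vec.[]) xs)) j ≡
  Maybe.map (λ a → if odd j then h a else g a) (at xs ⌊ j /2⌋)
at-concat g h Vec.[]       j             = refl
at-concat g h (_ Vec.∷ xs) zero          = refl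
at-concat g h (_ Vec.∷ xs) (suc zero)    = refl
at-concat g h (_ Vec.∷ xs) (suc (suc j)) rewrite at-concat g h xs j | not-involutive (odd j) = refl

entry-just : ∀ {X : Set} {m n} (rows : Mat X m n) {i j r} → at rows i ≡ just r → entry rows i j ≡ at r j
entry-just rows eq rewrite eq = refl

entry-expand : ∀ {X Y : Set} {m n} (f : X → Block Y) (rows : Mat X m n) i j {a} →
  entry rows ⌊ i /2⌋ ⌊ j /2⌋ ≡ just a → entry (expand f rows) i j ≡ just (pick (odd i) (odd j) (f a))
entry-expand f rows i j {a} eq with at rows ⌊ i /2⌋ in e
... | just r = trans (entry-just (expand f rows) (trans (at-concat _ _ rows i) (cong (Maybe.map _) e))) (half (odd i))
  where
  half : ∀ b → at (if b then concat (Vec.map (λ a → y (f a) Vec.∷ z (f a) Vec.∷ Vec.[]) r)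
                       else concat (Vec.map (λ a → w (f a) Vec.∷ x (f a) Vec.∷ Vec.[]) r)) j ≡ just (pick b (odd j) (f a))
  half true  = trans (at-concat _ _ r j) (cong (Maybe.map _) eq)
  half false = trans (at-concat _ _ r j) (cong (Maybe.map _) eq)

letterAt : ℕ → ℕ → ℕ → Letter
letterAt k i j = letterOf (hE^ k h₀ i j) (odd i xor odd j) (odd i) (vE^ k v₀ i j)

side≡2^ : ∀ k → side k ≡ 2 ^ k
side≡2^ zero    = refl
side≡2^ (suc k) = trans (*-comm (side k) 2) (cong (2 *_) (side≡2^ k))

-- N is the letter of the limit plane at (0 , 3), so T k is its image, the block of size 2 ^ k at (0 , 3 * 2 ^ k).
T-entry : ∀ k i j → i < 2 ^ k → j < 2 ^ k → entry (T k) i j ≡ just (letterAt (suc k) i (j + 2 ^ k * 3))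
T-entry zero    zero    zero    _ _ = refl
T-entry zero    (suc i) j       (s≤s ())
T-entry zero    zero    (suc j) _ (s≤s ())
T-entry (suc k) i j i< j< = trans
  (entry-expand μ (T k) i j (T-entry k ⌊ i /2⌋ ⌊ j /2⌋ (half-< i<) (half-< j<)))
  (cong just (trans (pick-μ (odd i) (odd j) _ _ _ _) grown))
  where
  grown : letterOf (if odd j then odd ⌊ i /2⌋ xor odd (⌊ j /2⌋ + 2 ^ k * 3) else hE^ (suc k) h₀ ⌊ i /2⌋ (⌊ j /2⌋ + 2 ^ k * 3))
                   (odd i xor odd j) (odd i)
                   (if odd i then vE^ (suc k) v₀ ⌊ i /2⌋ (⌊ j /2⌋ + 2 ^ k * 3) else odd ⌊ i /2⌋ xor odd j)
          ≡ letterAt (2 + k) i (j + 2 ^ suc k * 3)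
  grown rewrite sym (half-shift k j 3) | sym (odd-shift k j 3) = refl

symAt : Plane → Plane → ℕ → ℕ → Sym
symAt h v i j = symOf (h i j) (v i j)

ST-entry : ∀ k i j → i < 2 ^ suc k → j < 2 ^ suc k →
  entry (ST k) i j ≡ just (symAt (hE^ (2 + k) h₀) (vE^ (2 + k) v₀) i (j + 2 ^ suc k * 3))
ST-entry k i j i< j< = trans
  (entry-expand φ (T k) i j (T-entry k ⌊ i /2⌋ ⌊ j /2⌋ (half-< i<) (half-< j<)))
  (cong just (trans (pick-φ (odd i) (odd j) _ _ _ _) grown))
  where
  grown : symOf (if odd j then odd ⌊ i /2⌋ xor odd (⌊ j /2⌋ + 2 ^ k * 3) else hE^ (suc k) h₀ ⌊ i /2⌋ (⌊ j /2⌋ + 2 ^ k * 3))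
                (if odd i then vE^ (suc k) v₀ ⌊ i /2⌋ (⌊ j /2⌋ + 2 ^ k * 3) else odd ⌊ i /2⌋ xor odd j)
          ≡ symAt (hE^ (2 + k) h₀) (vE^ (2 + k) v₀) i (j + 2 ^ suc k * 3)
  grown rewrite sym (half-shift k j 3) | sym (odd-shift k j 3) = refl

-- Windows

win : ∀ n → Site → Mat Sym n n
win n (site h v i j) = tabulate λ r → tabulate λ c → symAt h v (toℕ r + i) (toℕ c + j)

win-cong : ∀ {n} p p′ → Same n p p′ → win n p ≡ win n p′
win-cong p p′ same = tabulate-cong λ r → tabulate-cong λ c →
  cong₂ symOf (proj₁ (same (toℕ r) (toℕ c) (toℕ<n r) (toℕ<n c))) (proj₂ (same (toℕ r) (toℕ c) (toℕ<n r) (toℕ<n c)))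

lookup-win : ∀ n h v i j (r c : Fin n) →
  lookup (lookup (win n (site h v i j)) r) c ≡ symAt h v (toℕ r + i) (toℕ c + j)
lookup-win n h v i j r c = trans
  (cong (λ row → lookup row c) (lookup∘tabulate (λ r → tabulate λ c → symAt h v (toℕ r + i) (toℕ c + j)) r))
  (lookup∘tabulate _ c)

win-injective : ∀ {n} p p′ → win n p ≡ win n p′ → Same n p p′
win-injective {n} (site h v i j) (site h′ v′ i′ j′) eq r c r< c< = symOf-injective (begin
  symAt h v (r + i) (c + j)                                            ≡⟨ at-win h v i j ⟨
  lookup (lookup (win n (site h v i j)) (fromℕ< r<)) (fromℕ< c<)       ≡⟨ cong (λ m → lookup (lookup m (fromℕ< r<)) (fromℕ< c<)) eq ⟩
  lookup (lookup (win n (site h′ v′ i′ j′)) (fromℕ< r<)) (fromℕ< c<)   ≡⟨ at-win h′ v′ i′ j′ ⟩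
  symAt h′ v′ (r + i′) (c + j′)                                        ∎)
  where
  open ≡-Reasoning
  at-win : ∀ h v i j → lookup (lookup (win n (site h v i j)) (fromℕ< r<)) (fromℕ< c<) ≡ symAt h v (r + i) (c + j)
  at-win h v i j = trans (lookup-win n h v i j (fromℕ< r<) (fromℕ< c<))
    (cong₂ (λ r c → symAt h v (r + i) (c + j)) (toℕ-fromℕ< r<) (toℕ-fromℕ< c<))

patch : ℕ → ℕ → ℕ → Site
patch k i j = site (hE^ (2 + k) h₀) (vE^ (2 + k) v₀) i (j + 2 ^ suc k * 3)

side*2 : ∀ k → side k * 2 ≡ 2 ^ suc k
side*2 k = side≡2^ (suc k)

+toℕ< : ∀ {n m} i (r : Fin n) → i + n ≤ m → i + toℕ r < m
+toℕ< i r le = <-≤-trans (+-monoʳ-< i (toℕ<n r)) le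

ST-entry-win : ∀ {n} k i j → i + n ≤ 2 ^ suc k → j + n ≤ 2 ^ suc k → (r c : Fin n) →
  entry (ST k) (i + toℕ r) (j + toℕ c) ≡ just (lookup (lookup (win n (patch k i j)) r) c)
ST-entry-win {n} k i j i≤ j≤ r c = begin
  entry (ST k) (i + toℕ r) (j + toℕ c)
    ≡⟨ ST-entry k (i + toℕ r) (j + toℕ c) (+toℕ< i r i≤) (+toℕ< j c j≤) ⟩
  just (symAt h v (i + toℕ r) (j + toℕ c + 2 ^ suc k * 3))
    ≡⟨ cong₂ (λ a b → just (symAt h v a b)) (+-comm i (toℕ r))
         (trans (cong (_+ 2 ^ suc k * 3) (+-comm j (toℕ c))) (+-assoc (toℕ c) j _)) ⟩
  just (symAt h v (toℕ r + i) (toℕ c + (j + 2 ^ suc k * 3)))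
    ≡⟨ cong just (lookup-win n h v i (j + 2 ^ suc k * 3) r c) ⟨
  just (lookup (lookup (win n (patch k i j)) r) c) ∎
  where
  open ≡-Reasoning
  h = hE^ (2 + k) h₀
  v = vE^ (2 + k) v₀

mat-ext : ∀ {X : Set} {m n} (X₁ X₂ : Mat X m n) → (∀ r c → lookup (lookup X₁ r) c ≡ lookup (lookup X₂ r) c) → X₁ ≡ X₂
mat-ext X₁ X₂ eq = vec-ext X₁ X₂ λ r → vec-ext _ _ (eq r)
  where
  vec-ext : ∀ {X : Set} {n} (xs ys : Vec X n) → (∀ i → lookup xs i ≡ lookup ys i) → xs ≡ ys
  vec-ext xs ys eq = trans (sym (tabulate∘lookup xs)) (trans (tabulate-cong eq) (tabulate∘lookup ys))

InS⇒patch : ∀ {n} (Q : Mat Sym n n) → InS Q →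
  ∃ λ k → ∃ λ i → ∃ λ j → n ≤ 2 ^ suc k × Q ≡ win n (patch k i j)
InS⇒patch {n} Q (k , i , j , i≤ , j≤ , eq) = k , i , j , ≤-trans (m≤n+m n i) i≤′ , mat-ext _ _ λ r c →
  just-injective (trans (sym (eq r c)) (ST-entry-win k i j i≤′ (subst (j + n ≤_) (side*2 k) j≤) r c))
  where
  i≤′ : i + n ≤ 2 ^ suc k
  i≤′ = subst (i + n ≤_) (side*2 k) i≤

patch⇒InS : ∀ {n} k i j → i + n ≤ 2 ^ suc k → j + n ≤ 2 ^ suc k → InS (win n (patch k i j))
patch⇒InS {n} k i j i≤ j≤ = k , i , j ,
  subst (i + n ≤_) (sym (side*2 k)) i≤ , subst (j + n ≤_) (sym (side*2 k)) j≤ , ST-entry-win k i j i≤ j≤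

hE^-+ : ∀ m k h → hE^ (m + k) h ≡ hE^ m (hE^ k h)
hE^-+ zero    k h = refl
hE^-+ (suc m) k h = cong hE (hE^-+ m k h)

vE^-+ : ∀ m k v → vE^ (m + k) v ≡ vE^ m (vE^ k v)
vE^-+ zero    k v = refl
vE^-+ (suc m) k v = cong vE (vE^-+ m k v)

site-cong : ∀ {h h′ v v′ i i′ j j′} → h ≡ h′ → v ≡ v′ → i ≡ i′ → j ≡ j′ → site h v i j ≡ site h′ v′ i′ j′
site-cong refl refl refl refl = refl

-- Patterns of S as windows with a position and a valid code

module Patterns (l n : ℕ) (n≤wid : n ≤ 2 ^ suc l) where
  open Window l n

  window : ℕ → ℕ → Code → Mat Sym n n
  window u q c = win n (zoom (suc l) u q (siteOf c))

  window-view : ∀ {u q} c c′ → u < wid → q < wid → view u q c ≡ view u q c′ → window u q c ≡ window u q c′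
  window-view {u} {q} c c′ u< q< eq = win-cong
    (zoom (suc l) u q (siteOf c)) (zoom (suc l) u q (siteOf c′)) (view⇒Same n≤wid u< q< (siteOf c) (siteOf c′)
    (trans (cong (view u q) (codeAt-siteOf c)) (trans eq (cong (view u q) (sym (codeAt-siteOf c′))))))

  -- The 2 + k steps behind `ST k` split into suc l for the block and suc d for the coarse planes;
  -- the extra coarse step is the one that `valid-at` requires.
  InS⇒window : (∀ k → n ≤ 2 ^ suc k → l ≤ k) → ∀ Q → InS Q →
    ∃ λ u → ∃ λ q → ∃ λ c → u < wid × q < wid × c ∈ validCodes × Q ≡ window u q c
  InS⇒window large Q inS with InS⇒patch Q inS
  ... | k , i , j , n≤ , refl with m≤n⇒∃[o]m+o≡n (large k n≤)
  -- The column is positive, hence of the form suc o; it is o that is reduced modulo the block size,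
  -- to match `zoom`.
  ...   | d , refl with m≤n⇒∃[o]m+o≡n {1} {j + 2 ^ suc (l + d) * 3} (≤-trans (*-mono-≤ (m^n>0 2 (suc (l + d))) (s≤s (z≤n {2}))) (m≤n+m _ j))
  ...     | o , eqo = i % wid , o % wid , codeAt p , m%n<n i wid , m%n<n o wid ,
                      valid⇒∈ (codeAt p) (valid-at (hE^ d h₀) (vE^ d v₀) (Maekawa-level d) (i / wid) (o / wid)) ,
                      trans (cong (win n) patch≡) (win-cong (zoom (suc l) (i % wid) (o % wid) p) (zoom (suc l) (i % wid) (o % wid) (siteOf (codeAt p)))
                        (view⇒Same n≤wid (m%n<n i wid) (m%n<n o wid) p (siteOf (codeAt p))
                          (cong (view (i % wid) (o % wid)) (sym (codeAt-siteOf (codeAt p))))))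
    where
    instance _ = m^n≢0 2 (suc l)
    p : Site
    p = site (hE^ (suc d) h₀) (vE^ (suc d) v₀) (i / wid) (o / wid)
    split : ∀ i → i ≡ i % wid + wid * (i / wid)
    split i = trans (m≡m%n+[m/n]*n i wid) (cong (i % wid +_) (*-comm (i / wid) wid))
    levels : 2 + (l + d) ≡ suc l + suc d
    levels = cong suc (sym (+-suc l d))
    patch≡ : patch (l + d) i j ≡ zoom (suc l) (i % wid) (o % wid) p
    patch≡ = site-cong
      (trans (cong (λ m → hE^ m h₀) levels) (hE^-+ (suc l) (suc d) h₀))
      (trans (cong (λ m → vE^ m v₀) levels) (vE^-+ (suc l) (suc d) v₀))
      (split i)
      (trans (sym eqo) (cong suc (split o)))

  -- `ST (l + 4)` consists of 16 × 16 blocks. The indices in `places` are at most 14, so a window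
  -- starting in such a block still fits when it runs into the next one.
  window⇒InS : ∀ u q c → u < wid → q < wid → c ∈ validCodes → InS (window u q c)
  window⇒InS u q c u< q< c∈ with ∈-map⁻ (λ ab → codeAt (place-site ab)) {xs = places} (subst (c ∈_) validCodes-placed c∈)
  ... | (a , b) , _ , refl = subst InS (sym (trans
            (win-cong (zoom (suc l) u q (siteOf c)) (zoom (suc l) u q p) (view⇒Same n≤wid u< q< (siteOf c) p (cong (view u q) (codeAt-siteOf c))))
            (cong (win n) (sym patch≡))))
          (patch⇒InS (l + 4) (u + wid * toℕ a) (suc q + wid * toℕ b) (fits (<⇒≤ u<) a) (fits q< b))
    where
    p : Site
    p = place-site (a , b)
    levels : 2 + (l + 4) ≡ suc l + 5
    levels = cong suc (sym (+-suc l 4))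
    size : 2 ^ suc (l + 4) ≡ wid * 16
    size = ^-distribˡ-+-* 2 (suc l) 4
    fits : ∀ {x} → x ≤ wid → (t : Fin 15) → x + wid * toℕ t + n ≤ 2 ^ suc (l + 4)
    fits {x} x≤ t = begin
      x + wid * toℕ t + n        ≤⟨ +-mono-≤ (+-monoˡ-≤ _ x≤) n≤wid ⟩
      wid + wid * toℕ t + wid    ≡⟨ lemma wid (toℕ t) ⟩
      wid * (2 + toℕ t)          ≤⟨ *-monoʳ-≤ wid (s≤s (toℕ<n t)) ⟩
      wid * 16                   ≡⟨ size ⟨
      2 ^ suc (l + 4)            ∎
      where
      open ≤-Reasoning
      lemma : ∀ w t → w + w * t + w ≡ w * (2 + t)
      lemma = solve-∀
    patch≡ : patch (l + 4) (u + wid * toℕ a) (suc q + wid * toℕ b) ≡ zoom (suc l) u q p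
    patch≡ = site-cong
      (trans (cong (λ m → hE^ m h₀) levels) (hE^-+ (suc l) 5 h₀))
      (trans (cong (λ m → vE^ m v₀) levels) (vE^-+ (suc l) 5 v₀))
      refl
      (trans (cong (λ s → suc q + wid * toℕ b + s * 3) size) (lemma wid (suc q) (toℕ b)))
      where
      lemma : ∀ w x b → x + w * b + w * 16 * 3 ≡ x + w * (b + 48)
      lemma = solve-∀

-- Opaque, since unfolding a symbolic deduplication is very expensive.
opaque
  views : Flags → Flags → List Code
  views rf cf = deduplicate (≡-dec Boolₚ._≟_) (map (mask rf cf) validCodes)

  views-unique : ∀ rf cf → Unique (views rf cf)
  views-unique rf cf = deduplicate-! (≡-dec Boolₚ._≟_) (map (mask rf cf) validCodes)

  ∈-views⁻ : ∀ rf cf {c} → c ∈ views rf cf → ∃ λ c′ → c′ ∈ validCodes × c ≡ mask rf cf c′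
  ∈-views⁻ rf cf c∈ = ∈-map⁻ (mask rf cf) (∈-deduplicate⁻ (≡-dec Boolₚ._≟_) (map (mask rf cf) validCodes) c∈)

  ∈-views⁺ : ∀ rf cf {c} → c ∈ validCodes → mask rf cf c ∈ views rf cf
  ∈-views⁺ rf cf c∈ = ∈-deduplicate⁺ (≡-dec Boolₚ._≟_) (∈-map⁺ (mask rf cf) c∈)

count : Flags → Flags → ℕ
count rf cf = length (views rf cf)

-- Summing the visible codes over all positions

sumTo : (ℕ → ℕ) → ℕ → ℕ
sumTo f zero    = 0
sumTo f (suc n) = f 0 + sumTo (λ i → f (suc i)) n

sumTo-+ : ∀ f m n → sumTo f (m + n) ≡ sumTo f m + sumTo (λ i → f (m + i)) n
sumTo-+ f zero    n = refl
sumTo-+ f (suc m) n = trans (cong (f 0 +_) (sumTo-+ (λ i → f (suc i)) m n)) (sym (+-assoc (f 0) _ _))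

sumTo-const : ∀ {f c} n → (∀ i → i < n → f i ≡ c) → sumTo f n ≡ n * c
sumTo-const zero    eq = refl
sumTo-const (suc n) eq = cong₂ _+_ (eq 0 (s≤s z≤n)) (sumTo-const n (λ i i< → eq (suc i) (s≤s i<)))

sumTo-cong : ∀ {f f′} n → (∀ i → f i ≡ f′ i) → sumTo f n ≡ sumTo f′ n
sumTo-cong zero    eq = refl
sumTo-cong (suc n) eq = cong₂ _+_ (eq 0) (sumTo-cong n (λ i → eq (suc i)))

le-by : ∀ {x y} o → x + o ≡ y → x ≤ y
le-by {x} o eq = subst (x ≤_) eq (m≤m+n x o)

-- The negation is stated as an inequality too, so that le-by proves either case.
Cmp : Bool → ℕ → ℕ → Set
Cmp true  u v = u ≤ v
Cmp false u v = v < u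

Cmp₂ : Bool → ℕ → ℕ → ℕ → ℕ → Set
Cmp₂ true  u v u′ v′ = u ≤ v ⊎ u′ ≤ v′
Cmp₂ false u v u′ v′ = v < u × v′ < u′

does-≤? : ∀ {u v} b → Cmp b u v → does (u ≤? v) ≡ b
does-≤? {u} {v} true  u≤v = dec-true (u ≤? v) u≤v
does-≤? {u} {v} false v<u = dec-false (u ≤? v) (<⇒≱ v<u)

does-≤?₂ : ∀ {u v u′ v′} b → Cmp₂ b u v u′ v′ → does (u ≤? v) ∨ does (u′ ≤? v′) ≡ b
does-≤?₂ {u} {v} {u′} {v′} true (inj₁ u≤v) = cong (_∨ does (u′ ≤? v′)) (dec-true (u ≤? v) u≤v)
does-≤?₂ {u} {v} {u′} {v′} true (inj₂ u′≤v′) =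
  trans (cong (does (u ≤? v) ∨_) (dec-true (u′ ≤? v′) u′≤v′)) (∨-zeroʳ (does (u ≤? v)))
does-≤?₂ {u} {v} {u′} {v′} false (v<u , v′<u′) =
  cong₂ _∨_ (dec-false (u ≤? v) (<⇒≱ v<u)) (dec-false (u′ ≤? v′) (<⇒≱ v′<u′))

triple : ∀ {a a′ b b′ c c′ : Bool} → a ≡ a′ → b ≡ b′ → c ≡ c′ → (a , b , c) ≡ (a′ , b′ , c′)
triple refl refl refl = refl

-- The window size is m + suc g, where m = suc g + p is half of the block size.
rowFlagsAt colFlagsAt : ℕ → ℕ → ℕ → Flags
rowFlagsAt g p = rowFlagsOf (2 * (suc g + p)) (suc g + p) (suc g + p + suc g)
colFlagsAt g p = colFlagsOf (2 * (suc g + p)) (suc g + p) (suc g + p + suc g)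

row≡ : ∀ g p u a b c →
  Cmp₂ a (suc u) (suc g + p) (2 * (suc g + p) + (suc g + p)) (u + (suc g + p + suc g)) →
  Cmp b (2 * (suc g + p)) (u + (suc g + p + suc g)) →
  Cmp c (suc (2 * (suc g + p))) (u + (suc g + p + suc g)) → rowFlagsAt g p u ≡ (a , b , c)
row≡ g p u a b c ta tb tc = triple (does-≤?₂ a ta) (does-≤? b tb) (does-≤? c tc)

col≡ : ∀ g p q a b c →
  Cmp₂ a (suc q) (suc g + p) (2 * (suc g + p) + (suc g + p)) (q + (suc g + p + suc g)) →
  Cmp b (2 * (suc g + p)) (q + (suc g + p + suc g)) →
  Cmp c (2 + q) (2 * (suc g + p)) → colFlagsAt g p q ≡ (a , b , c)
col≡ g p q a b c ta tb tc = triple (does-≤?₂ a ta) (does-≤? b tb) (does-≤? c tc)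

rowA : ∀ g p i → i < p → rowFlagsAt g p i ≡ (true , false , false)
rowA g p i i<p with m≤n⇒∃[o]m+o≡n i<p
... | o , refl = row≡ g (suc i + o) i true false false
  (inj₁ (le-by (suc g + o) (solve (g ∷ i ∷ o ∷ []))))
  (le-by o (solve (g ∷ i ∷ o ∷ [])))
  (le-by (suc o) (solve (g ∷ i ∷ o ∷ [])))

rowB : ∀ g p i → i < 1 → rowFlagsAt g p (p + i) ≡ (true , true , false)
rowB g p zero _ = row≡ g p (p + 0) true true false
  (inj₁ (le-by g (solve (g ∷ p ∷ []))))
  (le-by 0 (solve (g ∷ p ∷ [])))
  (le-by 0 (solve (g ∷ p ∷ [])))
rowB g p (suc _) (s≤s ())

rowC : ∀ g p i → i < g → rowFlagsAt g p (p + (1 + i)) ≡ (true , true , true)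
rowC g p i i<g with m≤n⇒∃[o]m+o≡n i<g
... | o , refl = row≡ (suc i + o) p (p + (1 + i)) true true true
  (inj₁ (le-by o (solve (p ∷ i ∷ o ∷ []))))
  (le-by (suc i) (solve (p ∷ i ∷ o ∷ [])))
  (le-by i (solve (p ∷ i ∷ o ∷ [])))

rowD : ∀ g p i → i < p → rowFlagsAt g p (p + (1 + (g + i))) ≡ (false , true , true)
rowD g p i i<p with m≤n⇒∃[o]m+o≡n i<p
... | o , refl = row≡ g (suc i + o) (suc i + o + (1 + (g + i))) false true true
  (le-by i (solve (g ∷ i ∷ o ∷ [])) , le-by o (solve (g ∷ i ∷ o ∷ [])))
  (le-by (suc (g + i)) (solve (g ∷ i ∷ o ∷ [])))
  (le-by (g + i) (solve (g ∷ i ∷ o ∷ [])))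

rowC′ : ∀ g p i → rowFlagsAt g p (p + (1 + (g + (p + i)))) ≡ (true , true , true)
rowC′ g p i = row≡ g p (p + (1 + (g + (p + i)))) true true true
  (inj₂ (le-by i (solve (g ∷ p ∷ i ∷ []))))
  (le-by (suc (g + p + i)) (solve (g ∷ p ∷ i ∷ [])))
  (le-by (g + p + i) (solve (g ∷ p ∷ i ∷ [])))

colA : ∀ g p i → i < p → colFlagsAt g p i ≡ (true , false , true)
colA g p i i<p with m≤n⇒∃[o]m+o≡n i<p
... | o , refl = col≡ g (suc i + o) i true false true
  (inj₁ (le-by (suc g + o) (solve (g ∷ i ∷ o ∷ []))))
  (le-by o (solve (g ∷ i ∷ o ∷ [])))
  (le-by (2 * g + o + (1 + o + (1 + i))) (solve (g ∷ i ∷ o ∷ [])))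

colC : ∀ g p i → i < suc g → 2 ≤ suc g + p → colFlagsAt g p (p + i) ≡ (true , true , true)
colC g p i i<g 2≤ with m≤n⇒∃[o]m+o≡n i<g
... | o , refl = col≡ (i + o) p (p + i) true true true
  (inj₁ (le-by o (solve (p ∷ i ∷ o ∷ []))))
  (le-by i (solve (p ∷ i ∷ o ∷ [])))
  (≤-trans (+-monoˡ-≤ (p + i) 2≤) (le-by (suc o) (lemma i o p)))
  where
  lemma : ∀ i o p → suc (i + o) + p + (p + i) + suc o ≡ 2 * (suc (i + o) + p)
  lemma = solve-∀

colD : ∀ g p i → i < p → colFlagsAt g p (p + (suc g + i)) ≡ (false , true , true)
colD g p i i<p with m≤n⇒∃[o]m+o≡n i<p
... | o , refl = col≡ g (suc i + o) (suc i + o + (suc g + i)) false true true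
  (le-by i (solve (g ∷ i ∷ o ∷ [])) , le-by o (solve (g ∷ i ∷ o ∷ [])))
  (le-by (suc (g + i)) (solve (g ∷ i ∷ o ∷ [])))
  (le-by (g + o) (solve (g ∷ i ∷ o ∷ [])))

colC′ : ∀ g p i → i < g → colFlagsAt g p (p + (suc g + (p + i))) ≡ (true , true , true)
colC′ g p i i<g with m≤n⇒∃[o]m+o≡n i<g
... | o , refl = col≡ (suc i + o) p (p + (suc (suc i + o) + (p + i))) true true true
  (inj₂ (le-by i (solve (p ∷ i ∷ o ∷ []))))
  (le-by (2 + i + o + p + i) (solve (p ∷ i ∷ o ∷ [])))
  (le-by o (solve (p ∷ i ∷ o ∷ [])))

colB : ∀ g p i → i < 1 → colFlagsAt g p (p + (suc g + (p + (g + i)))) ≡ (true , true , false)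
colB g p zero _ = col≡ g p (p + (suc g + (p + (g + 0)))) true true false
  (inj₂ (le-by g (solve (g ∷ p ∷ []))))
  (le-by (suc (2 * g) + p) (solve (g ∷ p ∷ [])))
  (le-by 0 (solve (g ∷ p ∷ [])))
colB g p (suc _) (s≤s ())

-- As q grows the flags change four times, giving runs of length p, g + 1, p, g and 1. In the last
-- run the window starts on the grid column itself.
sum-cols : ∀ g p (f : Flags → ℕ) → 2 ≤ suc g + p →
  sumTo (λ q → f (colFlagsAt g p q)) (2 * (suc g + p)) ≡
  p * f (true , false , true) + (suc g * f (true , true , true) + (p * f (false , true , true) +
    (g * f (true , true , true) + 1 * f (true , true , false))))
sum-cols g p f 2≤ = begin
  sumTo fl (2 * (suc g + p))
    ≡⟨ cong (sumTo fl) size ⟩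
  sumTo fl (p + (suc g + (p + (g + 1))))
    ≡⟨ sumTo-+ fl p _ ⟩
  sumTo fl p + sumTo (λ i → fl (p + i)) (suc g + (p + (g + 1)))
    ≡⟨ cong₂ _+_ (sumTo-const p (λ i i< → cong f (colA g p i i<)))
      (trans (sumTo-+ (λ i → fl (p + i)) (suc g) _)
      (cong₂ _+_ (sumTo-const (suc g) (λ i i< → cong f (colC g p i i< 2≤)))
      (trans (sumTo-+ (λ i → fl (p + (suc g + i))) p _)
      (cong₂ _+_ (sumTo-const p (λ i i< → cong f (colD g p i i<)))
      (trans (sumTo-+ (λ i → fl (p + (suc g + (p + i)))) g _)
      (cong₂ _+_ (sumTo-const g (λ i i< → cong f (colC′ g p i i<)))
                 (sumTo-const 1 (λ i i< → cong f (colB g p i i<))))))))) ⟩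
  p * f (true , false , true) + (suc g * f (true , true , true) + (p * f (false , true , true) +
    (g * f (true , true , true) + 1 * f (true , true , false)))) ∎
  where
  open ≡-Reasoning
  fl : ℕ → ℕ
  fl q = f (colFlagsAt g p q)
  size : 2 * (suc g + p) ≡ p + (suc g + (p + (g + 1)))
  size = solve (g ∷ p ∷ [])

-- The run of length 1 is u = p, where the grid row is the last row of the window, so nothing below
-- it is seen.
sum-rows : ∀ g p (f : Flags → ℕ) →
  sumTo (λ u → f (rowFlagsAt g p u)) (2 * (suc g + p)) ≡
  p * f (true , false , false) + (1 * f (true , true , false) + (g * f (true , true , true) +
    (p * f (false , true , true) + suc g * f (true , true , true))))
sum-rows g p f = begin
  sumTo fl (2 * (suc g + p))
    ≡⟨ cong (sumTo fl) size ⟩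
  sumTo fl (p + (1 + (g + (p + suc g))))
    ≡⟨ sumTo-+ fl p _ ⟩
  sumTo fl p + sumTo (λ i → fl (p + i)) (1 + (g + (p + suc g)))
    ≡⟨ cong₂ _+_ (sumTo-const p (λ i i< → cong f (rowA g p i i<)))
      (trans (sumTo-+ (λ i → fl (p + i)) 1 (g + (p + suc g)))
      (cong₂ _+_ (sumTo-const 1 (λ i i< → cong f (rowB g p i i<)))
      (trans (sumTo-+ (λ i → fl (p + (1 + i))) g (p + suc g))
      (cong₂ _+_ (sumTo-const g (λ i i< → cong f (rowC g p i i<)))
      (trans (sumTo-+ (λ i → fl (p + (1 + (g + i)))) p (suc g))
      (cong₂ _+_ (sumTo-const p (λ i i< → cong f (rowD g p i i<)))
                 (sumTo-const (suc g) (λ i _ → cong f (rowC′ g p i))))))))) ⟩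
  p * f (true , false , false) + (1 * f (true , true , false) + (g * f (true , true , true) +
    (p * f (false , true , true) + suc g * f (true , true , true)))) ∎
  where
  open ≡-Reasoning
  fl : ℕ → ℕ
  fl u = f (rowFlagsAt g p u)
  size : 2 * (suc g + p) ≡ p + (1 + (g + (p + suc g)))
  size = solve (g ∷ p ∷ [])

opaque
  unfolding views

  -- Stated additively, so that the ring solver applies and no truncated subtraction occurs.
  total : ∀ g p → 2 ≤ suc g + p →
    sumTo (λ u → sumTo (λ q → count (rowFlagsAt g p u) (colFlagsAt g p q)) (2 * (suc g + p))) (2 * (suc g + p))
      + 4 + 16 * ((suc g + p) * (suc g + p)) ≡
    12 * (suc g + p + suc g) ^ 2 + 24 * (suc g + p + suc g) * (suc g + p)
  total g p 2≤ = trans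
    (cong (λ s → s + 4 + 16 * ((suc g + p) * (suc g + p)))
      (trans (sum-rows g p (λ r → sumTo (λ q → count r (colFlagsAt g p q)) (2 * (suc g + p))))
      (cong₂ (λ a t → p * a + t) (cols (true , false , false))
      (cong₂ (λ a t → 1 * a + t) (cols (true , true , false))
      (cong₂ (λ a t → g * a + t) (cols (true , true , true))
      (cong₂ (λ a t → p * a + suc g * t) (cols (false , true , true)) (cols (true , true , true))))))))
    (poly g p)
    where
    cols : ∀ r → sumTo (λ q → count r (colFlagsAt g p q)) (2 * (suc g + p)) ≡
      p * count r (true , false , true) + (suc g * count r (true , true , true) + (p * count r (false , true , true) +
        (g * count r (true , true , true) + 1 * count r (true , true , false))))
    cols r = sum-cols g p (count r) 2≤
    -- The literals are the values of `count` on closed flags, matched by evaluation since `views`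
    -- is unfolded here. The value 20 means that all valid codes are told apart.
    poly : ∀ g p →
      p * (p * 4 + (suc g * 8 + (p * 4 + (g * 8 + 1 * 8)))) +
      (1 * (p * 8 + (suc g * 20 + (p * 12 + (g * 20 + 1 * 16)))) +
      (g * (p * 8 + (suc g * 20 + (p * 12 + (g * 20 + 1 * 20)))) +
      (p * (p * 4 + (suc g * 16 + (p * 8 + (g * 16 + 1 * 16)))) +
      suc g * (p * 8 + (suc g * 20 + (p * 12 + (g * 20 + 1 * 20)))))))
      + 4 + 16 * ((suc g + p) * (suc g + p)) ≡
      12 * ((suc g + p + suc g) * ((suc g + p + suc g) * 1)) + 24 * (suc g + p + suc g) * (suc g + p)
    poly = solve-∀

-- Duplicate-free lists of indices

module _ {X Y : Set} where

  pairs : List X → (X → List Y) → List (X × Y)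
  pairs xs f = concatMap (λ a → map (a ,_) (f a)) xs

  ∈-pairs⁺ : ∀ {xs f a b} → a ∈ xs → b ∈ f a → (a , b) ∈ pairs xs f
  ∈-pairs⁺ {xs} {f} {a} a∈ b∈ = ∈-concatMap⁺ (λ a → map (a ,_) (f a)) (lose a∈ (∈-map⁺ (a ,_) b∈))

  ∈-pairs⁻ : ∀ xs f {a b} → (a , b) ∈ pairs xs f → a ∈ xs × b ∈ f a
  ∈-pairs⁻ xs f ab∈ with find (∈-concatMap⁻ (λ a → map (a ,_) (f a)) {xs = xs} ab∈)
  ... | a , a∈ , ab∈′ with ∈-map⁻ (a ,_) ab∈′
  ...   | b , b∈ , refl = a∈ , b∈

  pairs-unique : ∀ {xs f} → Unique xs → (∀ a → Unique (f a)) → Unique (pairs xs f)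
  pairs-unique {xs} {f} xs! f! = Uniqueₚ.concat⁺
    (Allₚ.map⁺ (All.universal (λ a → Uniqueₚ.map⁺ (λ { refl → refl }) (f! a)) xs))
    (AllPairsₚ.map⁺ (AllPairs.map (λ a≢a′ {_} (y∈ , y∈′) → a≢a′ (trans (sym (first y∈)) (first y∈′))) xs!))
    where
    first : ∀ {a y} → y ∈ map (a ,_) (f a) → proj₁ y ≡ a
    first {a} y∈ with ∈-map⁻ (a ,_) y∈
    ... | _ , _ , refl = refl

length-pairs : ∀ {Y : Set} (f : ℕ → List Y) (e : ℕ → ℕ) n →
  length (pairs (applyUpTo e n) f) ≡ sumTo (λ i → length (f (e i))) n
length-pairs f e zero    = refl
length-pairs f e (suc n) = trans (length-++ (map (e 0 ,_) (f (e 0))))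
  (cong₂ _+_ (length-map _ (f (e 0))) (length-pairs f (λ i → e (suc i)) n))

-- Injectivity is asked on members only: codes that differ in a hidden bit give equal windows, so
-- only masked codes are indexed faithfully.
map-unique : ∀ {X Y : Set} (f : X → Y) {xs} → (∀ {a b} → a ∈ xs → b ∈ xs → f a ≡ f b → a ≡ b) →
  Unique xs → Unique (map f xs)
map-unique f inj AllPairs.[] = AllPairs.[]
map-unique f {a ∷ xs} inj (a∉ AllPairs.∷ xs!) =
  Allₚ.map⁺ (All.tabulate λ b∈ eq → All.lookup a∉ b∈ (inj (here refl) (there b∈) eq)) AllPairs.∷
  map-unique f (λ a∈ b∈ → inj (there a∈) (there b∈)) xs!

-- Lets a masked code stand for all codes with the same visible bits, although it may itself fail
-- `valid`.
mask-idem : ∀ rf cf c → mask rf cf (mask rf cf c) ≡ mask rf cf c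
mask-idem (fP , fR , fB) (fS , fC , fN) (code p s hA hB vA vB) =
  code-cong (idem fP p) (idem fS s) (idem fC hA) (idem (fC ∧ fB) hB) (idem (fR ∧ fN) vA) (idem (fR ∧ fC) vB)
  where
  idem : ∀ a b → a ∧ (a ∧ b) ≡ a ∧ b
  idem true  b = refl
  idem false b = refl

-- Windows of size 1 and 2

Sym-≟ : DecidableEquality Sym
Sym-≟ s t = map′ inj (cong bitsOf) (×-≡-dec Boolₚ._≟_ Boolₚ._≟_ (bitsOf s) (bitsOf t))
  where
  symOf-bitsOf : ∀ s → symOf (proj₁ (bitsOf s)) (proj₂ (bitsOf s)) ≡ s
  symOf-bitsOf s0 = refl
  symOf-bitsOf s1 = refl
  symOf-bitsOf s2 = refl
  symOf-bitsOf s3 = refl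
  inj : bitsOf s ≡ bitsOf t → s ≡ t
  inj eq = trans (sym (symOf-bitsOf s)) (trans (cong (λ b → symOf (proj₁ b) (proj₂ b)) eq) (symOf-bitsOf t))

-- Here a pattern need not determine its position, so the 2 * 2 * 20 = 80 candidates over blocks of
-- size 2 are compared as matrices.
module Small (n : ℕ) (n≤2 : n ≤ 2) where
  open Patterns 0 n n≤2

  sites : List (ℕ × ℕ × Code)
  sites = cartesianProduct (upTo 2) (cartesianProduct (upTo 2) validCodes)

  window-at : ℕ × ℕ × Code → Mat Sym n n
  window-at (u , q , c) = window u q c

  windows : List (Mat Sym n n)
  windows = deduplicate (≡-dec (≡-dec Sym-≟)) (map window-at sites)

  windows-complete : ∀ Q → Q ∈ windows ⇔ InS Q
  windows-complete Q = mk⇔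
    (λ Q∈ → to (∈-map⁻ window-at {xs = sites} (∈-deduplicate⁻ (≡-dec (≡-dec Sym-≟)) (map window-at sites) Q∈)))
    (λ inS → from (InS⇒window (λ _ _ → z≤n) Q inS))
    where
    to : ∀ {Q} → (∃ λ s → s ∈ sites × Q ≡ window-at s) → InS Q
    to ((u , q , c) , s∈ , refl) =
      let u∈ , qc∈ = ∈-cartesianProduct⁻ (upTo 2) (cartesianProduct (upTo 2) validCodes) s∈
          q∈ , c∈  = ∈-cartesianProduct⁻ (upTo 2) validCodes qc∈
      in window⇒InS u q c (∈-upTo⁻ u∈) (∈-upTo⁻ q∈) c∈
    from : ∀ {Q} → (∃ λ u → ∃ λ q → ∃ λ c → u < 2 × q < 2 × c ∈ validCodes × Q ≡ window u q c) → Q ∈ windows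
    from (_ , _ , _ , u< , q< , c∈ , refl) = ∈-deduplicate⁺ (≡-dec (≡-dec Sym-≟)) {xs = map window-at sites}
      (∈-map⁺ window-at {xs = sites} (∈-cartesianProduct⁺ (∈-upTo⁺ u<) (∈-cartesianProduct⁺ (∈-upTo⁺ q<) c∈)))

  small-count : PatternCount n (length windows)
  small-count = windows , deduplicate-! (≡-dec (≡-dec Sym-≟)) (map window-at sites) , windows-complete , refl

-- Larger windows

module Large (k n : ℕ) (3≤n : 3 ≤ n) (L<n : 2 ^ suc k < n) (n≤W : n ≤ 2 ^ (2 + k)) where
  open Window (suc k) n
  open Patterns (suc k) n n≤W

  indices : List (ℕ × ℕ × Code)
  indices = pairs (upTo wid) λ u → pairs (upTo wid) λ q → views (rowFlags u) (colFlags q)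

  indices-unique : Unique indices
  indices-unique = pairs-unique (Uniqueₚ.upTo⁺ wid) λ u → pairs-unique (Uniqueₚ.upTo⁺ wid) λ q →
    views-unique (rowFlags u) (colFlags q)

  ∈-indices⁻ : ∀ {u q c} → (u , q , c) ∈ indices → u < wid × q < wid × c ∈ views (rowFlags u) (colFlags q)
  ∈-indices⁻ {u} s∈ with ∈-pairs⁻ (upTo wid) (λ u → pairs (upTo wid) λ q → views (rowFlags u) (colFlags q)) s∈
  ... | u∈ , qc∈ with ∈-pairs⁻ (upTo wid) (λ q → views (rowFlags u) (colFlags q)) qc∈
  ...   | q∈ , c∈ = ∈-upTo⁻ u∈ , ∈-upTo⁻ q∈ , c∈

  window-at : ℕ × ℕ × Code → Mat Sym n n
  window-at (u , q , c) = window u q c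

  window-position : ∀ {u q u′ q′} c c′ → u < wid → q < wid → u′ < wid → q′ < wid →
    window u q c ≡ window u′ q′ c′ → u ≡ u′ × q ≡ q′
  window-position {u} {q} {u′} {q′} c c′ u< q< u′< q′< eq =
    same-position {k} (siteOf c) (siteOf c′) 3≤n (<⇒≤ L<n) u< q< u′< q′<
      (win-injective (zoom (2 + k) u q (siteOf c)) (zoom (2 + k) u′ q′ (siteOf c′)) eq)

  view-window : ∀ {u q} c c′ → u < wid → q < wid → window u q c ≡ window u q c′ → view u q c ≡ view u q c′
  view-window {u} {q} c c′ u< q< eq = begin
    view u q c                     ≡⟨ cong (view u q) (codeAt-siteOf c) ⟨
    view u q (codeAt (siteOf c))   ≡⟨ Same⇒view n≤W u< q< (<⇒≤ L<n) (≤-trans (s≤s z≤n) 3≤n) (siteOf c) (siteOf c′)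
      (win-injective (zoom (2 + k) u q (siteOf c)) (zoom (2 + k) u q (siteOf c′)) eq) ⟩
    view u q (codeAt (siteOf c′))  ≡⟨ cong (view u q) (codeAt-siteOf c′) ⟩
    view u q c′                    ∎
    where open ≡-Reasoning

  view-fixed : ∀ {u q c} → c ∈ views (rowFlags u) (colFlags q) → view u q c ≡ c
  view-fixed {u} {q} c∈ = fixed (∈-views⁻ (rowFlags u) (colFlags q) c∈)
    where
    fixed : ∀ {c} → (∃ λ c₀ → c₀ ∈ validCodes × c ≡ view u q c₀) → view u q c ≡ c
    fixed (c₀ , _ , refl) = mask-idem (rowFlags u) (colFlags q) c₀

  window-at-injective : ∀ {s s′} → s ∈ indices → s′ ∈ indices → window-at s ≡ window-at s′ → s ≡ s′
  window-at-injective {u , q , c} {u′ , q′ , c′} s∈ s′∈ eq = same-index (∈-indices⁻ s∈) (∈-indices⁻ s′∈)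
    where
    Index : ℕ → ℕ → Code → Set
    Index u q c = u < wid × q < wid × c ∈ views (rowFlags u) (colFlags q)
    same-code : Index u q c → Index u′ q′ c′ → u ≡ u′ × q ≡ q′ → (u , q , c) ≡ (u′ , q′ , c′)
    same-code (u< , q< , c∈) (_ , _ , c′∈) (refl , refl) = cong (λ c → u , q , c)
      (trans (sym (view-fixed c∈)) (trans (view-window c c′ u< q< eq) (view-fixed c′∈)))
    same-index : Index u q c → Index u′ q′ c′ → (u , q , c) ≡ (u′ , q′ , c′)
    same-index ι@(u< , q< , _) ι′@(u′< , q′< , _) = same-code ι ι′ (window-position c c′ u< q< u′< q′< eq)

  windows : List (Mat Sym n n)
  windows = map window-at indices

  -- A square too small to contain a full block is too small to contain the window.
  level-bound : ∀ j → n ≤ 2 ^ suc j → suc k ≤ j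
  level-bound j n≤ = ≮⇒≥ λ j<k → <⇒≱ L<n (≤-trans n≤ (^-monoʳ-≤ 2 j<k))

  window-view-InS : ∀ {u q c} → u < wid → q < wid → c ∈ views (rowFlags u) (colFlags q) → InS (window u q c)
  window-view-InS {u} {q} u< q< c∈ = realised (∈-views⁻ (rowFlags u) (colFlags q) c∈)
    where
    realised : ∀ {c} → (∃ λ c₀ → c₀ ∈ validCodes × c ≡ view u q c₀) → InS (window u q c)
    realised (c₀ , c₀∈ , refl) = subst InS
      (window-view c₀ (view u q c₀) u< q< (sym (mask-idem (rowFlags u) (colFlags q) c₀)))
      (window⇒InS u q c₀ u< q< c₀∈)

  window∈windows : ∀ {u q c} → u < wid → q < wid → c ∈ validCodes → window u q c ∈ windows
  window∈windows {u} {q} {c} u< q< c∈ = subst (_∈ windows)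
    (window-view (view u q c) c u< q< (mask-idem (rowFlags u) (colFlags q) c))
    (∈-map⁺ window-at {xs = indices} (∈-pairs⁺ (∈-upTo⁺ u<) (∈-pairs⁺ (∈-upTo⁺ q<) (∈-views⁺ (rowFlags u) (colFlags q) c∈))))

  windows-complete : ∀ Q → Q ∈ windows ⇔ InS Q
  windows-complete Q = mk⇔ (λ Q∈ → to (∈-map⁻ window-at {xs = indices} Q∈)) (λ inS → from (InS⇒window level-bound Q inS))
    where
    to : ∀ {Q} → (∃ λ s → s ∈ indices × Q ≡ window-at s) → InS Q
    to (_ , s∈ , refl) = let u< , q< , c∈ = ∈-indices⁻ s∈ in window-view-InS u< q< c∈
    from : ∀ {Q} → (∃ λ u → ∃ λ q → ∃ λ c → u < wid × q < wid × c ∈ validCodes × Q ≡ window u q c) → Q ∈ windows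
    from (_ , _ , _ , u< , q< , c∈ , refl) = window∈windows u< q< c∈

  length-windows : length windows ≡ sumTo (λ u → sumTo (λ q → count (rowFlags u) (colFlags q)) wid) wid
  length-windows = trans (length-map window-at indices)
    (trans (length-pairs (λ u → pairs (upTo wid) λ q → views (rowFlags u) (colFlags q)) (λ u → u) wid)
    (sumTo-cong wid λ u → length-pairs (λ q → views (rowFlags u) (colFlags q)) (λ q → q) wid))

  large-count : PatternCount n (sumTo (λ u → sumTo (λ q → count (rowFlags u) (colFlags q)) wid) wid)
  large-count = windows , map-unique window-at window-at-injective indices-unique , windows-complete , length-windows

-- The logarithm and the closed formula

⌊log₂⌋-bracket : ∀ m → 0 < m → 2 ^ ⌊log₂ m ⌋ ≤ m × m < 2 ^ suc ⌊log₂ m ⌋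
⌊log₂⌋-bracket = <-rec _ step
  where
  step : ∀ m → (∀ {j} → j < m → 0 < j → 2 ^ ⌊log₂ j ⌋ ≤ j × j < 2 ^ suc ⌊log₂ j ⌋) →
    0 < m → 2 ^ ⌊log₂ m ⌋ ≤ m × m < 2 ^ suc ⌊log₂ m ⌋
  step 1 _ _ = s≤s z≤n , s≤s (s≤s z≤n)
  step m@(suc (suc m′)) rec _ with rec {⌊ m /2⌋} (⌊n/2⌋<n (suc m′)) (s≤s z≤n)
  ... | lo , hi = subst (λ e → 2 ^ e ≤ m × m < 2 ^ suc e) (sym log-half)
      ( ≤-trans (*-monoʳ-≤ 2 lo) (≤half⇒2*≤ {m} ≤-refl)
      , half<⇒<2* {m} hi)
    where
    log-half : ⌊log₂ m ⌋ ≡ suc ⌊log₂ ⌊ m /2⌋ ⌋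
    log-half = sym (trans (cong suc (⌊log₂⌊n/2⌋⌋≡⌊log₂n⌋∸1 m)) (m+[n∸m]≡n {1} (⌊log₂⌋-mono-≤ {2} {m} (s≤s (s≤s z≤n)))))

4^≡ : ∀ k → 4 ^ k ≡ 2 ^ k * 2 ^ k
4^≡ k = trans (^-*-assoc 2 2 k) (trans (cong (λ i → 2 ^ (k + i)) (+-identityʳ k)) (^-distribˡ-+-* 2 k k))

count-formula : ∀ a n m t → t + 4 + 16 * (m * m) ≡ 12 * n ^ 2 + 24 * n * m → m ≡ 2 ^ a →
  t ≡ 12 * n ^ 2 + 24 * n * 2 ^ a ∸ 16 * 4 ^ a ∸ 4
count-formula a n m t eq refl = sym (begin
  12 * n ^ 2 + 24 * n * 2 ^ a ∸ 16 * 4 ^ a ∸ 4          ≡⟨ cong₂ (λ x y → x ∸ 16 * y ∸ 4) (sym eq) (4^≡ a) ⟩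
  t + 4 + 16 * (m * m) ∸ 16 * (m * m) ∸ 4               ≡⟨ cong (_∸ 4) (m+n∸n≡m (t + 4) (16 * (m * m))) ⟩
  t + 4 ∸ 4                                             ≡⟨ m+n∸n≡m t 4 ⟩
  t                                                     ∎)
  where open ≡-Reasoning

pattern-count : ∀ n → 3 ≤ n → PatternCount n (12 * n ^ 2 + 24 * n * 2 ^ ⌊log₂ (n ∸ 1) ⌋ ∸ 16 * 4 ^ ⌊log₂ (n ∸ 1) ⌋ ∸ 4)
pattern-count (suc j) 3≤n@(s≤s 2≤j) with ⌊log₂ j ⌋ | ⌊log₂⌋-bracket j (≤-trans (s≤s z≤n) 2≤j) | ⌊log₂⌋-mono-≤ 2≤j
-- Since n - 1 ≥ 2 the logarithm is positive. Half a block is 2 ^ suc k, and n exceeds it by suc g.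
... | suc k | lo , hi | _ with m≤n⇒∃[o]m+o≡n lo
...   | g , refl with m≤n⇒∃[o]m+o≡n {suc g} {2 ^ suc k} bound
  where
  bound : suc g ≤ 2 ^ suc k
  bound = +-cancelˡ-≤ (2 ^ suc k) (suc g) (2 ^ suc k)
    (subst₂ _≤_ (sym (+-suc (2 ^ suc k) g)) (cong (2 ^ suc k +_) (+-identityʳ _)) hi)
...     | p , eq = subst (PatternCount (suc (2 ^ suc k + g)))
          (count-formula (suc k) (suc (2 ^ suc k + g)) (2 ^ suc k) _ (totalled (2 ^ suc k) eq (*-monoʳ-≤ 2 (m^n>0 2 k))) refl)
          (Large.large-count k (suc (2 ^ suc k + g)) 3≤n (s≤s lo) hi)
  where
  -- The power of two is generalised to m, so that the equation with suc g + p can be eliminated.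
  totalled : ∀ m → suc g + p ≡ m → 2 ≤ m →
    sumTo (λ u → sumTo (λ q → count (rowFlagsOf (2 * m) m (suc (m + g)) u) (colFlagsOf (2 * m) m (suc (m + g)) q)) (2 * m)) (2 * m)
      + 4 + 16 * (m * m) ≡ 12 * suc (m + g) ^ 2 + 24 * suc (m + g) * m
  totalled m refl 2≤m = subst
    (λ n → sumTo (λ u → sumTo (λ q → count (rowFlagsOf (2 * m) m n u) (colFlagsOf (2 * m) m n q)) (2 * m)) (2 * m)
      + 4 + 16 * (m * m) ≡ 12 * n ^ 2 + 24 * n * m)
    (+-suc (suc g + p) g) (total g p 2≤m)

theorem1 : PatternCount 1 4 × PatternCount 2 68 ×
    ((n : ℕ) → 3 ≤ n →
    PatternCount n (12 * n ^ 2 + 24 * n * 2 ^ ⌊log₂ (n ∸ 1) ⌋ ∸ 16 * 4 ^ ⌊log₂ (n ∸ 1) ⌋ ∸ 4))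
-- The values 4 and 68 result from evaluating the length of the deduplicated lists.
theorem1 = Small.small-count 1 (s≤s z≤n) , Small.small-count 2 (s≤s (s≤s z≤n)) , pattern-count
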